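{- Let $Q_n$ denote the $n$-dimensional hypercube. Then $\mathrm{capt}(Q_n) = \Theta(n \ln n)$ as $n \to \infty$; that is, there are absolute constants $c_1, c_2 > 0$ and $n_0$ such that $c_1 n \ln n \le \mathrm{capt}(Q_n) \le c_2 n \ln n$ for all $n \ge n_0$.
   Context: Cops and Robbers is played on a finite reflexive graph (every vertex carries a loop, so a player may pass). A set of cops first chooses starting vertices (turn 0), then the robber chooses a starting vertex; afterwards players alternate, the cops moving first: on the cops' turn each cop moves to a neighbouring vertex or stays, and on the robber's turn the robber moves to a neighbouring vertex or stays. A round is a cop move together with the subsequent robber move. The cops win (capture the robber) when some cop occupies the same vertex as the robber. The cop number $c(G)$ is the minimum number of cops having a winning strategy. For $k \ge c(G)$, the $k$-capture time $\mathrm{capt}_k(G)$ is the minimum, over strategies of $k$ cops, of the number of rounds (not counting the initial round 0) needed to capture the robber, assuming the robber plays to delay capture as long as possible; $\mathrm{capt}(G) = \mathrm{capt}_{c(G)}(G)$. The hypercube $Q_n$ is the $n$-fold Cartesian product of $K_2$ (vertices are binary strings of length $n$, adjacent when they differ in exactly one coordinate); $c(Q_n) = \lceil (n+1)/2 \rceil$. -}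

module Defs where

open import Data.Nat using (ℕ; zero; suc; _≤_; _<_)
open import Data.Bool using (Bool; not)
open import Data.Fin using (Fin)
open import Data.Vec using (Vec; _[_]%=_)
open import Data.Vec.Relation.Unary.Any using (Any)
open import Data.Vec.Relation.Binary.Pointwise.Inductive using (Pointwise)
open import Data.Product using (Σ; ∃; _×_)
open import Data.Sum using (_⊎_)
open import Relation.Binary.PropositionalEquality using (_≡_)

-- A finite reflexive graph, given by its vertex type and its *closed*
-- neighbourhood relation: N u v means "v = u or v is adjacent to u",
-- i.e. the moves available from u (staying put = using the loop).
record RGraph : Set₁ where
  field
    V : Set
    N : V → V → Set

open RGraph public

Q : ℕ → RGraph
Q n = record
  { V = Vec Bool n
  ; N = λ u v → (u ≡ v) ⊎ (Σ (Fin n) λ i → v ≡ u [ i ]%= not)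
  }

module _ (G : RGraph) where

  Caught : ∀ {k} → Vec (V G) k → V G → Set
  Caught cs r = Any (λ c → c ≡ r) cs

  CopStep : ∀ {k} → Vec (V G) k → Vec (V G) k → Set
  CopStep cs cs' = Pointwise (N G) cs cs'

  -- CopsWinWithin t cs r : cops at cs, robber at r, cops to move; the cops
  -- have a strategy that captures the robber within at most t further
  -- rounds, whatever the robber does.  (Nested Σ/Π = history-dependent
  -- strategy in the game tree.)
  CopsWinWithin : ∀ {k} → ℕ → Vec (V G) k → V G → Set
  CopsWinWithin zero    cs r = Caught cs r
  CopsWinWithin (suc t) cs r =
    Caught cs r ⊎
    Σ (Vec (V G) _) λ cs' → CopStep cs cs' ×
      (Caught cs' r ⊎ (∀ r' → N G r r' → CopsWinWithin t cs' r'))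

  -- k cops can guarantee capture within t rounds (round 0 = placement:
  -- cops choose, then the robber chooses any starting vertex).
  CaptureWithin : ℕ → ℕ → Set
  CaptureWithin k t =
    Σ (Vec (V G) k) λ cs → ∀ r → CopsWinWithin t cs r

  -- k cops have a winning strategy (on a finite graph: capture in bounded time)
  CopsWin : ℕ → Set
  CopsWin k = ∃ λ t → CaptureWithin k t

  IsCopNumber : ℕ → Set
  IsCopNumber k = CopsWin k × (∀ j → j < k → CopsWin j → Data.Empty.⊥)
    where import Data.Empty

  IsCaptTime : ℕ → ℕ → Set
  IsCaptTime k t = CaptureWithin k t × (∀ s → s < t → CaptureWithin k s → Data.Empty.⊥)
    where import Data.Empty

  IsCapt : ℕ → Set
  IsCapt t = Σ ℕ λ k → IsCopNumber k × IsCaptTime k t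

{-# OPTIONS --safe #-}

-- Let X be the matrix whose i-th row is the set of coordinates in which cop i differs
-- from the robber.  A cop move flips one entry of its row, a robber move flips a whole
-- column, and the cops win when a row becomes empty.
--
-- Robber.  With 1 / (d + 1) as the weight of a cop at distance d, the total weight after a
-- cop move grows on average by a factor 1 + 2/n over the n robber moves.  As long as the
-- weight is below n / 16, fewer than half of the moves are threatened, so some safe move
-- costs a factor of at most 1 + 4/n.  Choosing the starting bits greedily puts every cop at
-- distance about n / 8, hence the initial weight is bounded, and the robber survives for
-- about (n / 8) log n rounds.  If twice the number of cops is at most n, then the cops never
-- threaten all n + 1 options of the robber.
--
-- Cops.  Half of them start at each of two antipodal vertices, so every coordinate lies in
-- s = m / 2 rows, where m is the number of cops.  When the robber flips column j, at least s
-- rows lose j.  If at least 2s rows lose it, then s of these cops undo the flip; otherwise s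
-- other cops keep j, which they just gained, and give up an element that stays covered s
-- times.  This is possible while the total size of the rows exceeds 4 n s, and the total
-- drops by s per round, so after O(n) rounds s may be halved.  For s = 1 counting shows
-- that a redundant element exists as long as there are more than n / 2 cops.

module Submission where

open import Defs
open import Data.Bool using (Bool; true; false; not; _xor_; _∧_; if_then_else_; T) renaming (_≟_ to _≟ᵇ_)
open import Data.Bool.Properties using (not-distribˡ-xor; not-distribʳ-xor; not-involutive; xor-same)
open import Data.Empty using (⊥)
open import Data.Fin using (Fin; zero; suc)
open import Data.Fin.Properties using (any?) renaming (_≟_ to _≟ᶠ_)
open import Data.Maybe using (Maybe; just; nothing)
open import Data.Nat
open import Data.Nat.Divisibility using (∣-trans; m∣m*n; m≤n⇒m!∣n!)
open import Data.Nat.DivMod using (m/n*n≡m; m/n*n≤m; m≡m%n+[m/n]*n; m%n<n)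
open import Data.Nat.Induction using (<-rec)
open import Data.Nat.Logarithm using (⌊log₂_⌋; ⌊log₂⌋-mono-≤; ⌊log₂⌊n/2⌋⌋≡⌊log₂n⌋∸1; ⌊log₂[2^n]⌋≡n)
open import Data.Nat.Properties
open import Data.Nat.Solver using (module +-*-Solver)
open import Data.Product using (Σ; ∃; _×_; _,_; proj₁; proj₂)
open import Data.Sum using (_⊎_; inj₁; inj₂)
open import Data.Unit using (tt)
open import Data.Vec using (Vec; []; _∷_; lookup; tabulate; _[_]%=_)
open import Data.Vec.Functional using (updateAt)
open import Data.Vec.Functional.Properties using (updateAt-updates; updateAt-minimal)
open import Data.Vec.Properties using (lookup∘tabulate; tabulate∘lookup; tabulate-cong; ≡-dec)
open import Data.Vec.Relation.Binary.Pointwise.Extensional using (ext; extensional⇒inductive)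
open import Data.Vec.Relation.Binary.Pointwise.Inductive as Pointwise using ()
open import Data.Vec.Relation.Unary.Any as Any using (Any; here; there)
open import Algebra.Properties.Semiring.Sum +-*-semiring using (sum; sum-cong-≗; ∑-distrib-+; ∑-comm; *-distribˡ-sum; *-distribʳ-sum)
open import Function using (_∘_; case_of_; const)
open import Relation.Binary.PropositionalEquality
open import Relation.Nullary using (Dec; yes; no; ¬_; contradiction; ¬?)
open import Relation.Nullary.Decidable using (map′; _×-dec_; _⊎-dec_; _→-dec_; decidable-stable)
open import Relation.Unary using (Decidable)

private variable
  m n t : ℕ

-- Sums over finite index sets.

sum-mono : {f g : Fin n → ℕ} → (∀ i → f i ≤ g i) → sum f ≤ sum g
sum-mono {zero}  f≤g = z≤n
sum-mono {suc n} f≤g = +-mono-≤ (f≤g zero) (sum-mono (f≤g ∘ suc))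

sum-const : ∀ n c → sum {n} (λ _ → c) ≡ n * c
sum-const zero    c = refl
sum-const (suc n) c = cong (c +_) (sum-const n c)

sum-≤-const : {f : Fin n → ℕ} {c : ℕ} → (∀ i → f i ≤ c) → sum f ≤ n * c
sum-≤-const {n} {c = c} f≤c = ≤-trans (sum-mono f≤c) (≤-reflexive (sum-const n c))

const-≤-sum : {f : Fin n → ℕ} {c : ℕ} → (∀ i → c ≤ f i) → n * c ≤ sum f
const-≤-sum {n} {c = c} c≤f = ≤-trans (≤-reflexive (sym (sum-const n c))) (sum-mono c≤f)

term≤sum : (f : Fin n → ℕ) (i : Fin n) → f i ≤ sum f
term≤sum f zero    = m≤m+n _ _
term≤sum f (suc i) = ≤-trans (term≤sum (f ∘ suc) i) (m≤n+m _ _)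

-- Averaging: the robber chooses its column by this argument.
sum<⇒∃< : (f : Fin n → ℕ) (M : ℕ) → sum f < n * M → ∃ λ i → f i < M
sum<⇒∃< {n} f M lt with any? (λ i → f i <? M)
... | yes p = p
... | no ¬p = contradiction lt (≤⇒≯ (const-≤-sum λ i → ≮⇒≥ λ q → ¬p (i , q)))

-- Difference matrices and moves.

bit : Bool → ℕ
bit true  = 1
bit false = 0

bit≤1 : ∀ b → bit b ≤ 1
bit≤1 true  = ≤-refl
bit≤1 false = z≤n

Row : ℕ → Set
Row n = Fin n → Bool

Matrix : ℕ → ℕ → Set
Matrix m n = Fin m → Row n

size : Row n → ℕ
size x = sum (bit ∘ x)

column : Fin n → Matrix m n → Row m
column l X i = X i l

deg : Matrix m n → Fin n → ℕ
deg X l = size (column l X)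

total : Matrix m n → ℕ
total X = sum (λ i → size (X i))

total≡sum-deg : (X : Matrix m n) → total X ≡ sum (deg X)
total≡sum-deg X = ∑-comm (λ i l → bit (X i l))

size-cong : {x y : Row n} → (∀ l → x l ≡ y l) → size x ≡ size y
size-cong eq = sum-cong-≗ (λ l → cong bit (eq l))

size≤n : (x : Row n) → size x ≤ n
size≤n {n} x = ≤-trans (sum-≤-const (bit≤1 ∘ x)) (≤-reflexive (*-identityʳ n))

size-empty : (x : Row n) → size x ≡ 0 → ∀ l → x l ≡ false
size-empty x e l with x l in xl
... | false = refl
... | true  = contradiction (≤-trans (≤-reflexive (sym (cong bit xl))) (≤-trans (term≤sum (bit ∘ x) l) (≤-reflexive e))) λ ()

empty-size : (x : Row n) → (∀ l → x l ≡ false) → size x ≡ 0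
empty-size {n} x e = trans (size-cong e) (trans (sum-const n 0) (*-zeroʳ n))

-- `nothing` is the loop of the reflexive graph, that is, passing.
move : Maybe (Fin n) → Row n → Row n
move nothing  x = x
move (just k) x = updateAt x k not

moves : (Fin m → Maybe (Fin n)) → Matrix m n → Matrix m n
moves a X i = move (a i) (X i)

flipAll : Maybe (Fin n) → Matrix m n → Matrix m n
flipAll a X i = move a (X i)

move-at : ∀ k (x : Row n) → move (just k) x k ≡ not (x k)
move-at k x = updateAt-updates k x

move-off : ∀ {k l} (x : Row n) → l ≢ k → move (just k) x l ≡ x l
move-off {k = k} {l} x l≢k = updateAt-minimal l k x l≢k

move-twice : ∀ (a : Maybe (Fin n)) x l → move a (move a x) l ≡ x l
move-twice nothing  x l = refl
move-twice (just k) x l with l ≟ᶠ k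
... | yes refl = trans (move-at k _) (trans (cong not (move-at k x)) (not-involutive _))
... | no l≢k = trans (move-off _ l≢k) (move-off x l≢k)

move-cong : ∀ (a : Maybe (Fin n)) {x y} → (∀ l → x l ≡ y l) → ∀ l → move a x l ≡ move a y l
move-cong nothing  eq l = eq l
move-cong (just k) {x} {y} eq l with l ≟ᶠ k
... | yes refl = trans (move-at k x) (trans (cong not (eq k)) (sym (move-at k y)))
... | no l≢k   = trans (move-off x l≢k) (trans (eq l) (sym (move-off y l≢k)))

move-xorˡ : ∀ (a : Maybe (Fin n)) (x y : Row n) l → move a x l xor y l ≡ move a (λ l → x l xor y l) l
move-xorˡ nothing  x y l = refl
move-xorˡ (just k) x y l with l ≟ᶠ k
... | yes refl = trans (cong (_xor y k) (move-at k x)) (trans (sym (not-distribˡ-xor (x k) (y k))) (sym (move-at k _)))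
... | no l≢k   = trans (cong (_xor y l) (move-off x l≢k)) (sym (move-off _ l≢k))

move-xorʳ : ∀ (a : Maybe (Fin n)) (x y : Row n) l → x l xor move a y l ≡ move a (λ l → x l xor y l) l
move-xorʳ nothing  x y l = refl
move-xorʳ (just k) x y l with l ≟ᶠ k
... | yes refl = trans (cong (x k xor_) (move-at k y)) (trans (sym (not-distribʳ-xor (x k) (y k))) (sym (move-at k _)))
... | no l≢k   = trans (cong (x l xor_) (move-off y l≢k)) (sym (move-off _ l≢k))

-- One equation covers insertion and removal without truncated subtraction.
size-move : ∀ k (x : Row n) → size (move (just k) x) + bit (x k) ≡ size x + bit (not (x k))
size-move zero x with x zero
... | true  = trans (+-comm _ 1) (sym (+-identityʳ _))
... | false = trans (+-identityʳ _) (+-comm 1 _)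
size-move (suc k) x = begin
  bit (x zero) + size (move (just k) (x ∘ suc)) + bit (x (suc k))   ≡⟨ +-assoc (bit (x zero)) _ _ ⟩
  bit (x zero) + (size (move (just k) (x ∘ suc)) + bit (x (suc k))) ≡⟨ cong (bit (x zero) +_) (size-move k (x ∘ suc)) ⟩
  bit (x zero) + (size (x ∘ suc) + bit (not (x (suc k))))           ≡⟨ +-assoc (bit (x zero)) _ _ ⟨
  bit (x zero) + size (x ∘ suc) + bit (not (x (suc k)))             ∎
  where open ≡-Reasoning

size-remove : ∀ {k} (x : Row n) → x k ≡ true → suc (size (move (just k) x)) ≡ size x
size-remove {k = k} x xk with size-move k x
... | e rewrite xk = trans (+-comm 1 _) (trans e (+-identityʳ _))

size-insert : ∀ {k} (x : Row n) → x k ≡ false → size (move (just k) x) ≡ suc (size x)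
size-insert {k = k} x xk with size-move k x
... | e rewrite xk = trans (sym (+-identityʳ _)) (trans e (+-comm _ 1))

size-move-≥ : ∀ (a : Maybe (Fin n)) x → size x ≤ suc (size (move a x))
size-move-≥ nothing  x = n≤1+n _
size-move-≥ (just k) x with x k in xk
... | true  = ≤-reflexive (sym (size-remove x xk))
... | false = ≤-trans (n≤1+n _) (≤-trans (≤-reflexive (sym (size-insert x xk))) (n≤1+n _))

-- The game on difference matrices.

Captured : Matrix m n → Set
Captured X = ∃ λ i → size (X i) ≡ 0

-- Translations are automorphisms of the cube, so only the differences from the robber matter. The
-- shape copies `CopsWinWithin`, so that strategies convert by recursion on the number of rounds.
Wins : ℕ → Matrix m n → Set
Wins zero    X = Captured X
Wins {m} {n} (suc t) X =
  Captured X ⊎ Σ (Fin m → Maybe (Fin n)) λ a →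
    Captured (moves a X) ⊎ (∀ b → Wins t (flipAll b (moves a X)))

Wins-suc : (X : Matrix m n) → Wins t X → Wins (suc t) X
Wins-suc {t = zero}  X c = inj₁ c
Wins-suc {t = suc t} X (inj₁ c) = inj₁ c
Wins-suc {t = suc t} X (inj₂ (a , inj₁ c)) = inj₂ (a , inj₁ c)
Wins-suc {t = suc t} X (inj₂ (a , inj₂ w)) = inj₂ (a , inj₂ λ b → Wins-suc {t = t} _ (w b))

Wins-mono : ∀ {s t} (X : Matrix m n) → s ≤ t → Wins s X → Wins t X
Wins-mono {t = t} X s≤t w = go (≤⇒≤′ s≤t)
  where
  go : ∀ {t} → _ ≤′ t → Wins t X
  go ≤′-refl = w
  go {suc t} (≤′-step p) = Wins-suc {t = t} X (go p)

-- From cube positions to matrices and back.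

Cube : ℕ → Set
Cube n = Vec Bool n

diff : Vec (Cube n) m → Cube n → Matrix m n
diff cs r i l = lookup (lookup cs i) l xor lookup r l

vmove : Maybe (Fin n) → Cube n → Cube n
vmove nothing  u = u
vmove (just k) u = u [ k ]%= not

lookup-vmove : ∀ (a : Maybe (Fin n)) u l → lookup (vmove a u) l ≡ move a (lookup u) l
lookup-vmove nothing  u l = refl
lookup-vmove (just zero)    (x ∷ u) zero    = refl
lookup-vmove (just zero)    (x ∷ u) (suc l) = refl
lookup-vmove (just (suc k)) (x ∷ u) zero    = refl
lookup-vmove (just (suc k)) (x ∷ u) (suc l) = lookup-vmove (just k) u l

vmove-step : ∀ (a : Maybe (Fin n)) u → N (Q n) u (vmove a u)
vmove-step nothing  u = inj₁ refl
vmove-step (just k) u = inj₂ (k , refl)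

step-vmove : ∀ {u v : Cube n} → N (Q n) u v → ∃ λ a → v ≡ vmove a u
step-vmove (inj₁ refl)    = nothing , refl
step-vmove (inj₂ (k , e)) = just k , e

lookup-injective : {u v : Cube n} → (∀ l → lookup u l ≡ lookup v l) → u ≡ v
lookup-injective {u = u} {v} eq =
  trans (sym (tabulate∘lookup u)) (trans (tabulate-cong eq) (tabulate∘lookup v))

xor-false⇒≡ : ∀ x y → x xor y ≡ false → x ≡ y
xor-false⇒≡ true  true  _ = refl
xor-false⇒≡ false false _ = refl

Any-lookup : {A : Set} {P : A → Set} (xs : Vec A m) (i : Fin m) → P (lookup xs i) → Any P xs
Any-lookup (x ∷ xs) zero    p = here p
Any-lookup (x ∷ xs) (suc i) p = there (Any-lookup xs i p)

lookup-Any : {A : Set} {P : A → Set} {xs : Vec A m} → Any P xs → ∃ λ i → P (lookup xs i)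
lookup-Any (here p)  = zero , p
lookup-Any (there a) = let i , p = lookup-Any a in suc i , p

module _ {m n : ℕ} where

  -- Rows are functions, so the correspondence is stated entry by entry. Moves of either player
  -- preserve it because flipping one argument of an xor flips the result.
  record Represents (X : Matrix m n) (cs : Vec (Cube n) m) (r : Cube n) : Set where
    constructor represents
    field entry : ∀ i l → X i l ≡ diff cs r i l

  open Represents

  captured⇒caught : ∀ {X cs r} → Represents X cs r → Captured X → Caught (Q n) cs r
  captured⇒caught {X} {cs} {r} rep (i , e) = Any-lookup cs i
    (lookup-injective λ l → xor-false⇒≡ _ _ (trans (sym (entry rep i l)) (size-empty (X i) e l)))

  caught⇒captured : ∀ {X cs r} → Represents X cs r → Caught (Q n) cs r → Captured X
  caught⇒captured {X} {cs} {r} rep c with lookup-Any c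
  ... | i , refl = i , empty-size (X i) λ l → trans (entry rep i l) (xor-same (lookup r l))

  represents-moves : ∀ {X cs r cs'} a → Represents X cs r →
                     (∀ i → lookup cs' i ≡ vmove (a i) (lookup cs i)) → Represents (moves a X) cs' r
  entry (represents-moves {X} {cs} {r} {cs'} a rep eq) i l = begin
    move (a i) (X i) l                                        ≡⟨ move-cong (a i) (entry rep i) l ⟩
    move (a i) (diff cs r i) l                                ≡⟨ move-xorˡ (a i) (lookup (lookup cs i)) (lookup r) l ⟨
    move (a i) (lookup (lookup cs i)) l xor lookup r l        ≡⟨ cong (_xor lookup r l) (lookup-vmove (a i) (lookup cs i) l) ⟨
    lookup (vmove (a i) (lookup cs i)) l xor lookup r l       ≡⟨ cong (λ v → lookup v l xor lookup r l) (eq i) ⟨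
    lookup (lookup cs' i) l xor lookup r l                    ∎
    where open ≡-Reasoning

  represents-flipAll : ∀ {X cs r} b → Represents X cs r → Represents (flipAll b X) cs (vmove b r)
  entry (represents-flipAll {X} {cs} {r} b rep) i l = begin
    move b (X i) l                                            ≡⟨ move-cong b (entry rep i) l ⟩
    move b (diff cs r i) l                                    ≡⟨ move-xorʳ b (lookup (lookup cs i)) (lookup r) l ⟨
    lookup (lookup cs i) l xor move b (lookup r) l            ≡⟨ cong (lookup (lookup cs i) l xor_) (lookup-vmove b r l) ⟨
    lookup (lookup cs i) l xor lookup (vmove b r) l           ∎
    where open ≡-Reasoning

  wins⇒copsWin : ∀ t {X cs r} → Represents X cs r → Wins t X → CopsWinWithin (Q n) t cs r
  wins⇒copsWin zero    rep w        = captured⇒caught rep w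
  wins⇒copsWin (suc t) rep (inj₁ c) = inj₁ (captured⇒caught rep c)
  wins⇒copsWin (suc t) {X} {cs} {r} rep (inj₂ (a , w)) = inj₂ (cs' , step , next w)
    where
    cs' : Vec (Cube n) m
    cs' = tabulate (λ i → vmove (a i) (lookup cs i))
    rep' : Represents (moves a X) cs' r
    rep' = represents-moves a rep (lookup∘tabulate _)
    step : CopStep (Q n) cs cs'
    step = extensional⇒inductive (ext λ i →
      subst (N (Q n) (lookup cs i)) (sym (lookup∘tabulate _ i)) (vmove-step (a i) (lookup cs i)))
    next : Captured (moves a X) ⊎ (∀ b → Wins t (flipAll b (moves a X))) →
           Caught (Q n) cs' r ⊎ (∀ r' → N (Q n) r r' → CopsWinWithin (Q n) t cs' r')
    next (inj₁ c)  = inj₁ (captured⇒caught rep' c)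
    next (inj₂ w') = inj₂ λ r' s → case step-vmove s of λ where
      (b , refl) → wins⇒copsWin t (represents-flipAll b rep') (w' b)

  copsWin⇒wins : ∀ t {X cs r} → Represents X cs r → CopsWinWithin (Q n) t cs r → Wins t X
  copsWin⇒wins zero    rep w        = caught⇒captured rep w
  copsWin⇒wins (suc t) rep (inj₁ c) = inj₁ (caught⇒captured rep c)
  copsWin⇒wins (suc t) {X} {cs} {r} rep (inj₂ (cs' , step , w)) = inj₂ (a , next w)
    where
    a : Fin m → Maybe (Fin n)
    a i = proj₁ (step-vmove (Pointwise.lookup step i))
    rep' : Represents (moves a X) cs' r
    rep' = represents-moves a rep (λ i → proj₂ (step-vmove (Pointwise.lookup step i)))
    next : Caught (Q n) cs' r ⊎ (∀ r' → N (Q n) r r' → CopsWinWithin (Q n) t cs' r') →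
           Captured (moves a X) ⊎ (∀ b → Wins t (flipAll b (moves a X)))
    next (inj₁ c)  = inj₁ (caught⇒captured rep' c)
    next (inj₂ w') = inj₂ λ b → copsWin⇒wins t (represents-flipAll b rep') (w' (vmove b r) (vmove-step b r))

-- The rows of `C` are the starting vertices of the cops and `R` is that of the robber; fixing `C`
-- before quantifying over `R` is round 0.
_⊕_ : Matrix m n → Row n → Matrix m n
(C ⊕ R) i l = C i l xor R l

wins⇒captureWithin : ∀ t (C : Matrix m n) → (∀ R → Wins t (C ⊕ R)) → CaptureWithin (Q n) m t
wins⇒captureWithin t C w = tabulate (λ i → tabulate (C i)) , λ r → wins⇒copsWin t
  (represents λ i l → cong (_xor lookup r l) (sym (trans (cong (λ u → lookup u l) (lookup∘tabulate _ i)) (lookup∘tabulate (C i) l))))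
  (w (lookup r))

captureWithin⇒wins : ∀ t → CaptureWithin (Q n) m t → Σ (Matrix m n) λ C → ∀ R → Wins t (C ⊕ R)
captureWithin⇒wins t (cs , w) = (λ i → lookup (lookup cs i)) , λ R → copsWin⇒wins t
  (represents λ i l → cong (lookup (lookup cs i) l xor_) (sym (lookup∘tabulate R l))) (w (tabulate R))

-- Evading and delaying capture

-- The indicator of `d ≤ k`, as a number so that it can be summed.
atMost : ℕ → ℕ → ℕ
atMost k       zero    = 1
atMost zero    (suc d) = 0
atMost (suc k) (suc d) = atMost k d

atMost-≤ : ∀ {k d} → d ≤ k → atMost k d ≡ 1
atMost-≤ z≤n     = refl
atMost-≤ (s≤s p) = atMost-≤ p

atMost-> : ∀ {k d} → k < d → atMost k d ≡ 0
atMost-> {zero}  (s≤s p) = refl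
atMost-> {suc k} (s≤s p) = atMost-> p

-- A cop at distance at most 2 captures on its next turn if the robber flips an entry of its row.
near : Row n → ℕ
near x = atMost 2 (size x)

adjacent : Row n → ℕ
adjacent x = atMost 1 (size x)

threat : Matrix m n → Fin n → ℕ
threat X j = sum λ i → near (X i) * bit (X i j)

sum-threat : (X : Matrix m n) → sum (threat X) ≡ sum λ i → near (X i) * size (X i)
sum-threat X = trans (∑-comm λ j i → near (X i) * bit (X i j))
  (sum-cong-≗ λ i → sym (*-distribˡ-sum (near (X i)) (bit ∘ X i)))

near*size≤ : (x : Row n) → near x * size x ≤ 2 * near x
near*size≤ x with size x ≤? 2
... | yes p rewrite atMost-≤ p = ≤-trans (≤-reflexive (+-identityʳ _)) p
... | no ¬p rewrite atMost-> (≰⇒> ¬p) = z≤n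

-- A cop at distance 1 threatens one column and the option of passing, a cop at distance 2 threatens
-- two columns, and any other cop threatens nothing.
near*size+adjacent≤2 : (x : Row n) → 1 ≤ size x → near x * size x + adjacent x ≤ 2
near*size+adjacent≤2 x 1≤ with size x
... | 1 = s≤s (s≤s z≤n)
... | 2 = s≤s (s≤s z≤n)
... | suc (suc (suc _)) = z≤n

-- A row with at least three entries can afford to lose one; a shorter row does not contain `j`, so
-- it grows.
unthreatened⇒escape : ∀ (X : Matrix m n) j → threat X j ≡ 0 → (∀ i → 1 ≤ size (X i)) →
                      ∀ i → 2 ≤ size (move (just j) (X i))
unthreatened⇒escape X j t0 1≤ i with size (X i) ≤? 2
... | no  ¬p = s≤s⁻¹ (≤-trans (≰⇒> ¬p) (size-move-≥ (just j) (X i)))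
... | yes p with X i j in xij
...   | false = ≤-trans (s≤s (1≤ i)) (≤-reflexive (sym (size-insert (X i) xij)))
...   | true  = contradiction (≤-trans (≤-reflexive (sym one)) (≤-trans (term≤sum (λ i → near (X i) * bit (X i j)) i) (≤-reflexive t0))) λ ()
  where
  one : near (X i) * bit (X i j) ≡ 1
  one = cong₂ _*_ (atMost-≤ p) (cong bit xij)

few-cops-escape : (X : Matrix m n) → 2 * m ≤ n → (∀ i → 1 ≤ size (X i)) →
                  ∃ λ b → ∀ i → 2 ≤ size (move b (X i))
few-cops-escape {m} {n} X 2m≤n 1≤ with sum (adjacent ∘ X) in eq
... | zero = nothing , safe
  where
  safe : ∀ i → 2 ≤ size (X i)
  safe i with size (X i) ≤? 1
  ... | no ¬p = ≰⇒> ¬p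
  ... | yes p = contradiction (≤-trans (≤-reflexive (sym (atMost-≤ p)))
                   (≤-trans (term≤sum (adjacent ∘ X) i) (≤-reflexive eq))) λ ()
... | suc s = let j , lt = sum<⇒∃< (threat X) 1 few in
    just j , unthreatened⇒escape X j (n<1⇒n≡0 lt) 1≤
  where
  open ≤-Reasoning
  few : sum (threat X) < n * 1
  few = begin-strict
    -- Some cop is adjacent, so passing uses up part of the 2m threats; this makes the inequality
    -- strict.
    sum (threat X)                                                  <⟨ m<m+n _ {suc s} z<s ⟩
    sum (threat X) + suc s                                          ≡⟨ cong₂ _+_ (sum-threat X) (sym eq) ⟩
    sum (λ i → near (X i) * size (X i)) + sum (adjacent ∘ X)        ≡⟨ ∑-distrib-+ (λ i → near (X i) * size (X i)) (adjacent ∘ X) ⟨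
    sum (λ i → near (X i) * size (X i) + adjacent (X i))            ≤⟨ sum-≤-const (λ i → near*size+adjacent≤2 (X i) (1≤ i)) ⟩
    m * 2                                                           ≡⟨ *-comm m 2 ⟩
    2 * m                                                           ≤⟨ 2m≤n ⟩
    n                                                               ≡⟨ *-identityʳ n ⟨
    n * 1                                                           ∎

not-captured : (X : Matrix m n) → (∀ i → 1 ≤ size (X i)) → ¬ Captured X
not-captured X 1≤ (i , e) = contradiction (≤-trans (1≤ i) (≤-reflexive e)) λ ()

moves-uncaught : (X : Matrix m n) → (∀ i → 2 ≤ size (X i)) → ∀ a i → 1 ≤ size (moves a X i)
moves-uncaught X 2≤ a i = s≤s⁻¹ (≤-trans (2≤ i) (size-move-≥ (a i) (X i)))

-- The invariant is that every cop is at distance at least 2 when the cops are to move, so no cop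
-- can capture at once.
few-cops-lose : 2 * m ≤ n → ∀ t (X : Matrix m n) → (∀ i → 2 ≤ size (X i)) → ¬ Wins t X
few-cops-lose _ zero X 2≤ = not-captured X (<⇒≤ ∘ 2≤)
few-cops-lose _ (suc t) X 2≤ (inj₁ c) = not-captured X (<⇒≤ ∘ 2≤) c
few-cops-lose 2m≤n (suc t) X 2≤ (inj₂ (a , inj₁ c)) = not-captured (moves a X) (moves-uncaught X 2≤ a) c
few-cops-lose 2m≤n (suc t) X 2≤ (inj₂ (a , inj₂ w)) =
  let b , safe = few-cops-escape (moves a X) 2m≤n (moves-uncaught X 2≤ a)
  in few-cops-lose 2m≤n t _ safe (w b)

-- A cop at distance d has weight L / (d + 1).  This choice turns the mean over the
-- n robber moves into the identity d (weight (d - 1) - weight (d + 1)) = 2 weight (d + 1).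
module Potential (n L : ℕ) .{{_ : NonZero L}} (weight : ℕ → ℕ)
                 (weight-* : ∀ {d} → d ≤ suc n → weight d * suc d ≡ L) where

  weight-antitone : ∀ {d e} → d ≤ e → e ≤ suc n → weight e ≤ weight d
  weight-antitone {d} {e} d≤e e≤ = *-cancelʳ-≤ (weight e) (weight d) (suc e) (begin
    weight e * suc e ≡⟨ weight-* e≤ ⟩
    L                ≡⟨ weight-* (≤-trans d≤e e≤) ⟨
    weight d * suc d ≤⟨ *-monoʳ-≤ (weight d) (s≤s d≤e) ⟩
    weight d * suc e ∎)
    where open ≤-Reasoning

  -- The difference in weight between the two outcomes of a robber move, coming closer and going
  -- away.
  gain : ℕ → ℕ
  gain d = weight (pred d) ∸ weight (suc d)

  *-gain : ∀ {d} → 1 ≤ d → d ≤ n → d * gain d ≡ 2 * weight (suc d)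
  *-gain {suc e} _ d≤n = begin
    suc e * (weight e ∸ w)         ≡⟨ *-distribˡ-∸ (suc e) (weight e) w ⟩
    suc e * weight e ∸ suc e * w   ≡⟨ cong (_∸ suc e * w) eq ⟩
    suc e * w + 2 * w ∸ suc e * w  ≡⟨ m+n∸m≡n (suc e * w) (2 * w) ⟩
    2 * w                          ∎
    where
    open ≡-Reasoning
    w = weight (suc (suc e))
    eq : suc e * weight e ≡ suc e * w + 2 * w
    eq = begin
      suc e * weight e       ≡⟨ *-comm (suc e) (weight e) ⟩
      weight e * suc e       ≡⟨ weight-* (≤-trans (n≤1+n e) (≤-trans d≤n (n≤1+n n))) ⟩
      L                      ≡⟨ weight-* (s≤s d≤n) ⟨
      w * (3 + e)            ≡⟨ solve 2 (λ w e → w :* (con 3 :+ e) := (con 1 :+ e) :* w :+ con 2 :* w) refl w e ⟩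
      suc e * w + 2 * w      ∎
      where open +-*-Solver

  Φ : Matrix m n → ℕ
  Φ X = sum λ i → weight (size (X i))

  -- The weight as if the robber's move led away from every cop. It is the baseline to which the
  -- gains are added, and it absorbs the preceding cop move, which brings each cop at most one step
  -- closer.
  Φ⁺ : Matrix m n → ℕ
  Φ⁺ X = sum λ i → weight (suc (size (X i)))

  Φ⁺-moves : ∀ (X : Matrix m n) a → Φ⁺ (moves a X) ≤ Φ X
  Φ⁺-moves X a = sum-mono λ i → weight-antitone (size-move-≥ (a i) (X i)) (s≤s (size≤n (moves a X i)))

  weight-move : ∀ j (x : Row n) → 1 ≤ size x →
                weight (size (move (just j) x)) ≡ weight (suc (size x)) + bit (x j) * gain (size x)
  weight-move j x 1≤ with x j in xj
  ... | false = trans (cong weight (size-insert x xj)) (sym (+-identityʳ _))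
  ... | true  = begin
    weight (size (move (just j) x))                ≡⟨ cong (weight ∘ pred) (size-remove x xj) ⟩
    weight (pred (size x))                         ≡⟨ m+[n∸m]≡n (weight-antitone (≤-trans pred[n]≤n (n≤1+n _)) (s≤s (size≤n x))) ⟨
    weight (suc (size x)) + gain (size x)          ≡⟨ cong (weight (suc (size x)) +_) (+-identityʳ _) ⟨
    weight (suc (size x)) + 1 * gain (size x)      ∎
    where open ≡-Reasoning

  gains : Matrix m n → Fin n → ℕ
  gains X j = sum λ i → bit (X i j) * gain (size (X i))

  Φ-flipAll : ∀ (X : Matrix m n) j → (∀ i → 1 ≤ size (X i)) → Φ (flipAll (just j) X) ≡ Φ⁺ X + gains X j
  Φ-flipAll X j 1≤ = trans (sum-cong-≗ λ i → weight-move j (X i) (1≤ i))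
    (∑-distrib-+ (λ i → weight (suc (size (X i)))) (λ i → bit (X i j) * gain (size (X i))))

  -- Exchanging the sums counts the gain of a cop once per entry of its row, and `*-gain` applies.
  -- Averaged over the columns, the growth is the fraction 2/n of the baseline.
  sum-gains : ∀ (X : Matrix m n) → (∀ i → 1 ≤ size (X i)) → sum (gains X) ≡ 2 * Φ⁺ X
  sum-gains X 1≤ = begin
    sum (gains X)                                   ≡⟨ ∑-comm (λ j i → bit (X i j) * gain (size (X i))) ⟩
    sum (λ i → sum λ j → bit (X i j) * gain (size (X i))) ≡⟨ sum-cong-≗ (λ i → *-distribʳ-sum (gain (size (X i))) (bit ∘ X i)) ⟨
    sum (λ i → size (X i) * gain (size (X i)))      ≡⟨ sum-cong-≗ (λ i → *-gain (1≤ i) (size≤n (X i))) ⟩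
    sum (λ i → 2 * weight (suc (size (X i))))       ≡⟨ *-distribˡ-sum 2 (λ i → weight (suc (size (X i)))) ⟨
    2 * Φ⁺ X                                        ∎
    where open ≡-Reasoning

  -- A near cop contributes at least L/4 to `Φ⁺`, so a small weight means few near cops.
  near-weight : (x : Row n) → near x * L ≤ 4 * weight (suc (size x))
  near-weight x with size x ≤? 2
  ... | no ¬p rewrite atMost-> (≰⇒> ¬p) = z≤n
  ... | yes p rewrite atMost-≤ p = begin
    L + 0                                    ≡⟨ +-identityʳ L ⟩
    L                                        ≡⟨ weight-* (s≤s (size≤n x)) ⟨
    weight (suc (size x)) * (2 + size x)     ≤⟨ *-monoʳ-≤ (weight (suc (size x))) (+-monoʳ-≤ 2 p) ⟩
    weight (suc (size x)) * 4                ≡⟨ *-comm (weight (suc (size x))) 4 ⟩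
    4 * weight (suc (size x))                ∎
    where open ≤-Reasoning

  module _ {m : ℕ} (X : Matrix m n) (1≤ : ∀ i → 1 ≤ size (X i)) (bound : 16 * Φ⁺ X ≤ n * L) where

    private
      open ≤-Reasoning
      c M : ℕ
      c = sum (near ∘ X)
      M = suc (4 * Φ⁺ X)

      4c≤n : 4 * c ≤ n
      4c≤n = *-cancelʳ-≤ (4 * c) n L (begin
        4 * c * L                                          ≡⟨ *-assoc 4 c L ⟩
        4 * (c * L)                                        ≡⟨ cong (4 *_) (*-distribʳ-sum L (near ∘ X)) ⟩
        4 * sum (λ i → near (X i) * L)                     ≤⟨ *-monoʳ-≤ 4 (sum-mono (near-weight ∘ X)) ⟩
        4 * sum (λ i → 4 * weight (suc (size (X i))))      ≡⟨ cong (4 *_) (*-distribˡ-sum 4 (λ i → weight (suc (size (X i))))) ⟨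
        4 * (4 * Φ⁺ X)                                     ≡⟨ *-assoc 4 4 (Φ⁺ X) ⟨
        16 * Φ⁺ X                                          ≤⟨ bound ⟩
        n * L                                              ∎)

      sum-threat≤ : sum (threat X) ≤ 2 * c
      sum-threat≤ = begin
        sum (threat X)                          ≡⟨ sum-threat X ⟩
        sum (λ i → near (X i) * size (X i))     ≤⟨ sum-mono (near*size≤ ∘ X) ⟩
        sum (λ i → 2 * near (X i))              ≡⟨ *-distribˡ-sum 2 (near ∘ X) ⟨
        2 * c                                   ∎

    -- One average meets two demands. A single threat already costs `M`, so a column cheaper than
    -- `M` is safe, and its gains times `n` are at most 4 `Φ⁺`.
    cost : Fin n → ℕ
    cost j = n * gains X j + M * threat X j

    -- Each of the two parts takes at most half of `n * M`: the gains because their sum is 2 `Φ⁺`,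
    -- and the threats because their number is at most `2 * c`, hence at most n/2. The successor in
    -- `M` makes it strict.
    sum-cost : .{{_ : NonZero n}} → sum cost < n * M
    sum-cost = *-cancelˡ-< 2 (sum cost) (n * M) (begin-strict
      2 * sum cost                                          ≡⟨ cong (2 *_) (∑-distrib-+ (λ j → n * gains X j) (λ j → M * threat X j)) ⟩
      2 * (sum (λ j → n * gains X j) + sum (λ j → M * threat X j))
        ≡⟨ cong (2 *_) (cong₂ _+_ (*-distribˡ-sum n (gains X)) (*-distribˡ-sum M (threat X))) ⟨
      2 * (n * sum (gains X) + M * sum (threat X))          ≤⟨ *-monoʳ-≤ 2 (+-monoʳ-≤ (n * sum (gains X)) (*-monoʳ-≤ M sum-threat≤)) ⟩
      2 * (n * sum (gains X) + M * (2 * c))                 ≡⟨ cong (λ g → 2 * (n * g + M * (2 * c))) (sum-gains X 1≤) ⟩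
      2 * (n * (2 * Φ⁺ X) + M * (2 * c))
        ≡⟨ solve 4 (λ n p M c → con 2 :* (n :* (con 2 :* p) :+ M :* (con 2 :* c)) := n :* (con 4 :* p) :+ M :* (con 4 :* c)) refl n (Φ⁺ X) M c ⟩
      n * (4 * Φ⁺ X) + M * (4 * c)                          ≤⟨ +-monoʳ-≤ (n * (4 * Φ⁺ X)) (*-monoʳ-≤ M 4c≤n) ⟩
      n * (4 * Φ⁺ X) + M * n                                <⟨ +-monoˡ-< (M * n) (*-monoʳ-< n (n<1+n (4 * Φ⁺ X))) ⟩
      n * M + M * n                                         ≡⟨ solve 2 (λ n M → n :* M :+ M :* n := con 2 :* (n :* M)) refl n M ⟩
      2 * (n * M)                                           ∎)
      where open +-*-Solver

    slow-escape : .{{_ : NonZero n}} → ∃ λ j →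
      (∀ i → 2 ≤ size (move (just j) (X i))) × n * Φ (flipAll (just j) X) ≤ (n + 4) * Φ⁺ X
    slow-escape = j , unthreatened⇒escape X j no-threat 1≤ , (begin
        n * Φ (flipAll (just j) X)           ≡⟨ cong (n *_) (Φ-flipAll X j 1≤) ⟩
        n * (Φ⁺ X + gains X j)               ≡⟨ *-distribˡ-+ n (Φ⁺ X) (gains X j) ⟩
        n * Φ⁺ X + n * gains X j             ≤⟨ +-monoʳ-≤ (n * Φ⁺ X) (≤-trans (m≤m+n (n * gains X j) (M * threat X j)) (s≤s⁻¹ lt)) ⟩
        n * Φ⁺ X + 4 * Φ⁺ X                  ≡⟨ *-distribʳ-+ (Φ⁺ X) n 4 ⟨
        (n + 4) * Φ⁺ X                       ∎)
      where
      cheap : ∃ λ j → cost j < M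
      cheap = sum<⇒∃< cost M sum-cost
      j : Fin n
      j = proj₁ cheap
      lt : cost j < M
      lt = proj₂ cheap
      no-threat : threat X j ≡ 0
      no-threat = n<1⇒n≡0 (≰⇒> λ 1≤threat → contradiction lt (≤⇒≯ (begin
        M                                  ≡⟨ *-identityʳ M ⟨
        M * 1                              ≤⟨ *-monoʳ-≤ M 1≤threat ⟩
        M * threat X j                     ≤⟨ m≤n+m _ (n * gains X j) ⟩
        cost j                             ∎)))

  -- The bound says, with denominators cleared, that `Φ` may grow by the factor 1 + 4/n in each of
  -- the `t` remaining rounds and still not exceed n L / 16, the limit under which `slow-escape`
  -- works.
  robber-survives : .{{_ : NonZero n}} → ∀ t (X : Matrix m n) → (∀ i → 2 ≤ size (X i)) →
                    16 * Φ X * (n + 4) ^ t ≤ L * n ^ suc t → ¬ Wins t X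
  robber-survives zero X 2≤ _ = not-captured X (<⇒≤ ∘ 2≤)
  robber-survives (suc t) X 2≤ _ (inj₁ c) = not-captured X (<⇒≤ ∘ 2≤) c
  robber-survives (suc t) X 2≤ _ (inj₂ (a , inj₁ c)) = not-captured (moves a X) (moves-uncaught X 2≤ a) c
  robber-survives (suc t) X 2≤ bound (inj₂ (a , inj₂ w)) =
    let j , safe , slow = slow-escape X' (moves-uncaught X 2≤ a) bound₀
    in robber-survives t (flipAll (just j) X') safe (bound′ _ slow) (w (just j))
    where
    open ≤-Reasoning
    open +-*-Solver
    X' = moves a X
    instance
      pow≢0 : NonZero (n ^ suc t)
      pow≢0 = m^n≢0 n (suc t)
    bound₀ : 16 * Φ⁺ X' ≤ n * L
    bound₀ = *-cancelʳ-≤ (16 * Φ⁺ X') (n * L) (n ^ suc t) (begin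
      16 * Φ⁺ X' * n ^ suc t          ≤⟨ *-mono-≤ (*-monoʳ-≤ 16 (Φ⁺-moves X a)) (^-monoˡ-≤ (suc t) (m≤m+n n 4)) ⟩
      16 * Φ X * (n + 4) ^ suc t      ≤⟨ bound ⟩
      L * (n * n ^ suc t)             ≡⟨ solve 3 (λ L n p → L :* (n :* p) := n :* L :* p) refl L n (n ^ suc t) ⟩
      n * L * n ^ suc t               ∎)
    bound′ : ∀ P → n * P ≤ (n + 4) * Φ⁺ X' → 16 * P * (n + 4) ^ t ≤ L * n ^ suc t
    bound′ P slow = *-cancelˡ-≤ n (begin
      n * (16 * P * q)                ≡⟨ solve 3 (λ n P q → n :* (con 16 :* P :* q) := con 16 :* (n :* P) :* q) refl n P q ⟩
      16 * (n * P) * q                ≤⟨ *-monoˡ-≤ q (*-monoʳ-≤ 16 (≤-trans slow (*-monoʳ-≤ (n + 4) (Φ⁺-moves X a)))) ⟩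
      16 * ((n + 4) * Φ X) * q        ≡⟨ solve 3 (λ k P q → con 16 :* (k :* P) :* q := con 16 :* P :* (k :* q)) refl (n + 4) (Φ X) q ⟩
      16 * Φ X * (n + 4) ^ suc t      ≤⟨ bound ⟩
      L * (n * n ^ suc t)             ≡⟨ solve 3 (λ L n p → L :* (n :* p) := n :* (L :* p)) refl L n (n ^ suc t) ⟩
      n * (L * n ^ suc t)             ∎)
      where q = (n + 4) ^ t

-- A starting vertex far from all cops.

^-distribʳ-* : ∀ a b k → (a * b) ^ k ≡ a ^ k * b ^ k
^-distribʳ-* a b zero    = refl
^-distribʳ-* a b (suc k) = trans (cong (a * b *_) (^-distribʳ-* a b k)) ([m*n]*[o*p]≡[m*o]*[n*p] a b (a ^ k) (b ^ k))

agreement : Row n → ℕ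
agreement x = size (not ∘ x)

size+agreement : (x : Row n) → size x + agreement x ≡ n
size+agreement {n} x = begin
  size x + agreement x                          ≡⟨ ∑-distrib-+ (bit ∘ x) (bit ∘ not ∘ x) ⟨
  sum (λ l → bit (x l) + bit (not (x l)))       ≡⟨ sum-cong-≗ (one ∘ x) ⟩
  sum {n} (λ _ → 1)                             ≡⟨ sum-const n 1 ⟩
  n * 1                                         ≡⟨ *-identityʳ n ⟩
  n                                             ∎
  where
  open ≡-Reasoning
  one : ∀ b → bit b + bit (not b) ≡ 1
  one true  = refl
  one false = refl

-- The robber's bits are chosen one at a time; over the two values of a bit the
-- weighted sum of 2 ^ agreement is multiplied by 3/2 on average.
spread : (w : Fin m → ℕ) (C : Matrix m n) →
         ∃ λ R → 2 ^ n * sum (λ i → w i * 2 ^ agreement ((C ⊕ R) i)) ≤ 3 ^ n * sum w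
spread {n = zero} w C = (λ ()) ,
  ≤-reflexive (cong (_+ 0) (sum-cong-≗ λ i → *-identityʳ (w i)))
spread {m} {suc n} w C = choose (≤-total (sum (w′ true)) (sum (w′ false)))
  where
  w′ : Bool → Fin m → ℕ
  w′ b i = w i * 2 ^ bit (not (C i zero xor b))

  both : ∀ i → w′ true i + w′ false i ≡ 3 * w i
  both i with C i zero
  ... | true  = solve 1 (λ w → w :* con 2 :+ w :* con 1 := con 3 :* w) refl (w i)
    where open +-*-Solver
  ... | false = solve 1 (λ w → w :* con 1 :+ w :* con 2 := con 3 :* w) refl (w i)
    where open +-*-Solver

  sum-both : sum (w′ true) + sum (w′ false) ≡ 3 * sum w
  sum-both = trans (sym (∑-distrib-+ (w′ true) (w′ false)))
    (trans (sum-cong-≗ both) (sym (*-distribˡ-sum 3 w)))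

  open ≤-Reasoning

  extend : ∀ b → 2 * sum (w′ b) ≤ 3 * sum w →
           ∃ λ R → 2 ^ suc n * sum (λ i → w i * 2 ^ agreement ((C ⊕ R) i)) ≤ 3 ^ suc n * sum w
  extend b le = R , (begin
    2 * 2 ^ n * sum (λ i → w i * 2 ^ agreement ((C ⊕ R) i))   ≡⟨ *-assoc 2 (2 ^ n) _ ⟩
    2 * (2 ^ n * sum (λ i → w i * 2 ^ agreement ((C ⊕ R) i))) ≡⟨ cong (λ s → 2 * (2 ^ n * s)) (sum-cong-≗ split) ⟩
    2 * (2 ^ n * sum (λ i → w′ b i * 2 ^ agreement ((C′ ⊕ R′) i))) ≤⟨ *-monoʳ-≤ 2 (proj₂ rest) ⟩
    2 * (3 ^ n * sum (w′ b))                                  ≡⟨ solve 2 (λ p s → con 2 :* (p :* s) := p :* (con 2 :* s)) refl (3 ^ n) (sum (w′ b)) ⟩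
    3 ^ n * (2 * sum (w′ b))                                  ≤⟨ *-monoʳ-≤ (3 ^ n) le ⟩
    3 ^ n * (3 * sum w)                                       ≡⟨ solve 2 (λ p s → p :* (con 3 :* s) := con 3 :* p :* s) refl (3 ^ n) (sum w) ⟩
    3 ^ suc n * sum w                                         ∎)
    where
    open +-*-Solver
    C′ : Matrix m n
    C′ i = C i ∘ suc
    rest = spread (w′ b) C′
    R′ = proj₁ rest
    R : Row (suc n)
    R zero    = b
    R (suc l) = R′ l
    split : ∀ i → w i * 2 ^ agreement ((C ⊕ R) i) ≡ w′ b i * 2 ^ agreement ((C′ ⊕ R′) i)
    split i = trans (cong (w i *_) (^-distribˡ-+-* 2 (bit (not (C i zero xor b))) (agreement ((C′ ⊕ R′) i))))
      (sym (*-assoc (w i) (2 ^ bit (not (C i zero xor b))) _))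

  choose : sum (w′ true) ≤ sum (w′ false) ⊎ sum (w′ false) ≤ sum (w′ true) →
           ∃ λ R → 2 ^ suc n * sum (λ i → w i * 2 ^ agreement ((C ⊕ R) i)) ≤ 3 ^ suc n * sum w
  choose (inj₁ le) = extend true (begin
    2 * sum (w′ true)                ≡⟨ cong (sum (w′ true) +_) (+-identityʳ _) ⟩
    sum (w′ true) + sum (w′ true)    ≤⟨ +-monoʳ-≤ (sum (w′ true)) le ⟩
    sum (w′ true) + sum (w′ false)   ≡⟨ sum-both ⟩
    3 * sum w                        ∎)
  choose (inj₂ le) = extend false (begin
    2 * sum (w′ false)               ≡⟨ cong (sum (w′ false) +_) (+-identityʳ _) ⟩
    sum (w′ false) + sum (w′ false)  ≤⟨ +-monoˡ-≤ (sum (w′ false)) le ⟩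
    sum (w′ true) + sum (w′ false)   ≡⟨ sum-both ⟩
    3 * sum w                        ∎)

-- A cop at distance `d` from the start given by `spread` would force the opposite inequality.
PowerGap : ℕ → ℕ → Set
PowerGap n d = n * 3 ^ n * 2 ^ d < 4 ^ n

powerGap-suc : ∀ {n d} → 3 ≤ n → PowerGap n d → PowerGap (suc n) d
powerGap-suc {n} {d} 3≤n gap = begin-strict
  suc n * (3 * p) * q     ≡⟨ solve 3 (λ n p q → (con 1 :+ n) :* (con 3 :* p) :* q := (con 3 :+ con 3 :* n) :* (p :* q)) refl n p q ⟩
  (3 + 3 * n) * (p * q)   ≤⟨ *-monoˡ-≤ (p * q) (+-monoˡ-≤ (3 * n) 3≤n) ⟩
  (n + 3 * n) * (p * q)   ≡⟨ solve 3 (λ n p q → (n :+ con 3 :* n) :* (p :* q) := con 4 :* (n :* p :* q)) refl n p q ⟩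
  4 * (n * p * q)         <⟨ *-monoʳ-< 4 gap ⟩
  4 * 4 ^ n               ∎
  where
  open ≤-Reasoning
  open +-*-Solver
  p = 3 ^ n
  q = 2 ^ d

-- The left side grows by at most the factor 2 · 2 · 3^8, where one 2 bounds (8 + n)/n; the right
-- side grows by 4^8.
powerGap-+8 : ∀ {n d} → 8 ≤ n → PowerGap n d → PowerGap (8 + n) (suc d)
powerGap-+8 {n} {d} 8≤n gap =
  subst₂ (λ a b → (8 + n) * a * (2 * 2 ^ d) < b) (sym (^-distribˡ-+-* 3 8 n)) (sym (^-distribˡ-+-* 4 8 n))
    (scaled (3 ^ 8) (4 ^ 8) (≤ᵇ⇒≤ (4 * 3 ^ 8) (4 ^ 8) _))
  where
  scaled : ∀ a b → .{{_ : NonZero b}} → 4 * a ≤ b → (8 + n) * (a * 3 ^ n) * (2 * 2 ^ d) < b * 4 ^ n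
  scaled a b 4a≤b = begin-strict
    (8 + n) * (a * p) * (2 * q)     ≤⟨ *-monoˡ-≤ (2 * q) (*-monoˡ-≤ (a * p) (+-monoˡ-≤ n 8≤n)) ⟩
    (n + n) * (a * p) * (2 * q)     ≡⟨ solve 4 (λ n a p q → (n :+ n) :* (a :* p) :* (con 2 :* q) := con 4 :* a :* (n :* p :* q)) refl n a p q ⟩
    4 * a * (n * p * q)             ≤⟨ *-monoˡ-≤ (n * p * q) 4a≤b ⟩
    b * (n * p * q)                 <⟨ *-monoʳ-< b gap ⟩
    b * 4 ^ n                       ∎
    where
    open ≤-Reasoning
    open +-*-Solver
    p = 3 ^ n
    q = 2 ^ d

powerGap-base : ∀ d → PowerGap (8 * suc d) d
powerGap-base zero    = ≤ᵇ⇒≤ _ _ _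
powerGap-base (suc d) = subst (λ k → PowerGap k (suc d)) (sym (*-suc 8 (suc d)))
  (powerGap-+8 {d = d} (m≤m*n 8 (suc d)) (powerGap-base d))

powerGap : ∀ {n d} → 8 * suc d ≤ n → PowerGap n d
powerGap {n} {d} le = go (≤⇒≤′ le)
  where
  go : ∀ {n} → 8 * suc d ≤′ n → PowerGap n d
  go ≤′-refl = powerGap-base d
  go (≤′-step p) = powerGap-suc {d = d}
    (≤-trans (≤-trans (≤ᵇ⇒≤ 3 8 _) (m≤m*n 8 (suc d))) (≤′⇒≤ p)) (go p)

-- A derandomised Chernoff bound: the single term `2 ^ agreement` of a cop is at most the whole sum
-- controlled by `spread`. As agreement and distance add up to `n`, this gives 4^n ≤ n 3^n 2^d,
-- which `powerGap` excludes for small `d`.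
far-start : m ≤ n → (C : Matrix m n) → ∃ λ R → ∀ i → n ≤ 8 * suc (size ((C ⊕ R) i))
far-start {m} {n} m≤n C = R , λ i → ≮⇒≥ λ near → contradiction (powerGap (<⇒≤ near)) (≤⇒≯ (far i))
  where
  open ≤-Reasoning
  open +-*-Solver
  initial = spread (λ _ → 1) C
  R = proj₁ initial
  far : ∀ i → 4 ^ n ≤ n * 3 ^ n * 2 ^ size ((C ⊕ R) i)
  far i = begin
    (2 * 2) ^ n                        ≡⟨ ^-distribʳ-* 2 2 n ⟩
    2 ^ n * 2 ^ n                      ≡⟨ cong (λ k → 2 ^ n * 2 ^ k) (size+agreement ((C ⊕ R) i)) ⟨
    2 ^ n * 2 ^ (d + e)                ≡⟨ cong (2 ^ n *_) (^-distribˡ-+-* 2 d e) ⟩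
    2 ^ n * (2 ^ d * 2 ^ e)            ≡⟨ solve 3 (λ a b c → a :* (b :* c) := a :* c :* b) refl (2 ^ n) (2 ^ d) (2 ^ e) ⟩
    2 ^ n * 2 ^ e * 2 ^ d              ≤⟨ *-monoˡ-≤ (2 ^ d) (*-monoʳ-≤ (2 ^ n) (≤-trans (≤-reflexive (sym (*-identityˡ (2 ^ e)))) (term≤sum (λ i → 1 * 2 ^ agreement ((C ⊕ R) i)) i))) ⟩
    2 ^ n * sum (λ i → 1 * 2 ^ agreement ((C ⊕ R) i)) * 2 ^ d ≤⟨ *-monoˡ-≤ (2 ^ d) (proj₂ initial) ⟩
    3 ^ n * sum {m} (λ _ → 1) * 2 ^ d  ≡⟨ cong (λ k → 3 ^ n * k * 2 ^ d) (trans (sum-const m 1) (*-identityʳ m)) ⟩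
    3 ^ n * m * 2 ^ d                  ≤⟨ *-monoˡ-≤ (2 ^ d) (*-monoʳ-≤ (3 ^ n) m≤n) ⟩
    3 ^ n * n * 2 ^ d                  ≡⟨ cong (_* 2 ^ d) (*-comm (3 ^ n) n) ⟩
    n * 3 ^ n * 2 ^ d                  ∎
    where
    d = size ((C ⊕ R) i)
    e = agreement ((C ⊕ R) i)

-- Growth of powers, and binary logarithms.

-- (1 + 4/n) ^ q ≤ 1 / (1 - 4q/n), where r = n - 4q.
bernoulli : ∀ q r {n} → n ≡ 4 * q + r → (n + 4) ^ q * r ≤ n ^ suc q
bernoulli zero    r {n} refl = ≤-reflexive (trans (+-identityʳ r) (sym (*-identityʳ r)))
bernoulli (suc q) r {n} eq = begin
  (n + 4) * p * r         ≡⟨ solve 3 (λ n p r → (n :+ con 4) :* p :* r := p :* (n :* r :+ con 4 :* r)) refl n p r ⟩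
  -- Replacing `4 * r` by `4 * n` lets a factor `n` be taken out, and the 4 left over raises `r` for
  -- the induction.
  p * (n * r + 4 * r)     ≤⟨ *-monoʳ-≤ p (+-monoʳ-≤ (n * r) (*-monoʳ-≤ 4 r≤n)) ⟩
  p * (n * r + 4 * n)     ≡⟨ solve 3 (λ n p r → p :* (n :* r :+ con 4 :* n) := n :* (p :* (con 4 :+ r))) refl n p r ⟩
  n * (p * (4 + r))       ≤⟨ *-monoʳ-≤ n (bernoulli q (4 + r) eq′) ⟩
  n * n ^ suc q           ∎
  where
  open ≤-Reasoning
  open +-*-Solver
  p = (n + 4) ^ q
  r≤n : r ≤ n
  r≤n = ≤-trans (m≤n+m r (4 * suc q)) (≤-reflexive (sym eq))
  eq′ : n ≡ 4 * q + (4 + r)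
  eq′ = trans eq (solve 2 (λ q r → con 4 :* (con 1 :+ q) :+ r := con 4 :* q :+ (con 4 :+ r)) refl q r)

-- In `bernoulli` the remainder `r` is at least n/2 when `8 * q ≤ n`.
pow-double : ∀ q {n} .{{_ : NonZero n}} → 8 * q ≤ n → (n + 4) ^ q ≤ 2 * n ^ q
pow-double q {n} 8q≤n = *-cancelʳ-≤ ((n + 4) ^ q) (2 * n ^ q) n (begin
  p * n               ≤⟨ *-monoʳ-≤ p n≤2r ⟩
  p * (2 * r)         ≡⟨ solve 2 (λ p r → p :* (con 2 :* r) := con 2 :* (p :* r)) refl p r ⟩
  2 * (p * r)         ≤⟨ *-monoʳ-≤ 2 (bernoulli q r eq) ⟩
  2 * (n * n ^ q)     ≡⟨ solve 2 (λ n p → con 2 :* (n :* p) := con 2 :* p :* n) refl n (n ^ q) ⟩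
  2 * n ^ q * n       ∎)
  where
  open ≤-Reasoning
  open +-*-Solver
  p = (n + 4) ^ q
  r = n ∸ 4 * q
  eq : n ≡ 4 * q + r
  eq = sym (m+[n∸m]≡n (≤-trans (*-monoˡ-≤ q (≤ᵇ⇒≤ 4 8 _)) 8q≤n))
  n≤2r : n ≤ 2 * r
  n≤2r = +-cancelˡ-≤ (8 * q) n (2 * r) (begin
    8 * q + n             ≤⟨ +-monoˡ-≤ n 8q≤n ⟩
    n + n                 ≡⟨ cong₂ _+_ eq eq ⟩
    4 * q + r + (4 * q + r) ≡⟨ solve 2 (λ q r → con 4 :* q :+ r :+ (con 4 :* q :+ r) := con 8 :* q :+ con 2 :* r) refl q r ⟩
    8 * q + 2 * r         ∎)

pow-growth : ∀ q k {n} .{{_ : NonZero n}} → 8 * q ≤ n → (n + 4) ^ (q * k) ≤ 2 ^ k * n ^ (q * k)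
pow-growth q k {n} 8q≤n = begin
  (n + 4) ^ (q * k)       ≡⟨ ^-*-assoc (n + 4) q k ⟨
  ((n + 4) ^ q) ^ k       ≤⟨ ^-monoˡ-≤ k (pow-double q 8q≤n) ⟩
  (2 * n ^ q) ^ k         ≡⟨ ^-distribʳ-* 2 (n ^ q) k ⟩
  2 ^ k * (n ^ q) ^ k     ≡⟨ cong (2 ^ k *_) (^-*-assoc n q k) ⟩
  2 ^ k * n ^ (q * k)     ∎
  where open ≤-Reasoning

⌊log₂⌋-bounds : ∀ n → 1 ≤ n → 2 ^ ⌊log₂ n ⌋ ≤ n × n < 2 ^ suc ⌊log₂ n ⌋
⌊log₂⌋-bounds = <-rec _ step
  where
  open ≤-Reasoning
  step : ∀ n → (∀ {k} → k < n → 1 ≤ k → 2 ^ ⌊log₂ k ⌋ ≤ k × k < 2 ^ suc ⌊log₂ k ⌋) →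
         1 ≤ n → 2 ^ ⌊log₂ n ⌋ ≤ n × n < 2 ^ suc ⌊log₂ n ⌋
  step 1 rec _ = s≤s z≤n , s≤s (s≤s z≤n)
  step n@(suc (suc n-2)) rec _ = (begin
      2 ^ ⌊log₂ n ⌋                  ≡⟨ cong (2 ^_) log-half ⟨
      2 * 2 ^ ⌊log₂ ⌊ n /2⌋ ⌋        ≤⟨ *-monoʳ-≤ 2 (proj₁ half) ⟩
      2 * ⌊ n /2⌋                    ≡⟨ cong (⌊ n /2⌋ +_) (+-identityʳ ⌊ n /2⌋) ⟩
      ⌊ n /2⌋ + ⌊ n /2⌋              ≤⟨ +-monoʳ-≤ ⌊ n /2⌋ (⌊n/2⌋≤⌈n/2⌉ n) ⟩
      ⌊ n /2⌋ + ⌈ n /2⌉              ≡⟨ ⌊n/2⌋+⌈n/2⌉≡n n ⟩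
      n                              ∎)
    , (begin-strict
      n                              <⟨ n<1+n n ⟩
      suc n                          ≡⟨ ⌊n/2⌋+⌈n/2⌉≡n (suc n) ⟨
      ⌈ n /2⌉ + suc ⌊ n /2⌋          ≤⟨ +-monoˡ-≤ (suc ⌊ n /2⌋) (⌊n/2⌋-mono {suc n} {suc (suc n)} (n≤1+n (suc n))) ⟩
      suc ⌊ n /2⌋ + suc ⌊ n /2⌋      ≡⟨ cong (suc ⌊ n /2⌋ +_) (+-identityʳ (suc ⌊ n /2⌋)) ⟨
      2 * suc ⌊ n /2⌋                ≤⟨ *-monoʳ-≤ 2 (proj₂ half) ⟩
      2 * 2 ^ suc ⌊log₂ ⌊ n /2⌋ ⌋    ≡⟨ cong (λ e → 2 * 2 ^ e) log-half ⟩
      2 * 2 ^ ⌊log₂ n ⌋              ∎)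
    where
    half = rec (⌊n/2⌋<n (suc n-2)) (s≤s z≤n)
    log-half : suc ⌊log₂ ⌊ n /2⌋ ⌋ ≡ ⌊log₂ n ⌋
    log-half = trans (cong suc (⌊log₂⌊n/2⌋⌋≡⌊log₂n⌋∸1 n))
      (m+[n∸m]≡n {1} (⌊log₂⌋-mono-≤ {2} {n} (s≤s (s≤s z≤n))))

≤-⌊log₂⌋ : ∀ k {n} → 2 ^ k ≤ n → k ≤ ⌊log₂ n ⌋
≤-⌊log₂⌋ k le = ≤-trans (≤-reflexive (sym (⌊log₂[2^n]⌋≡n k))) (⌊log₂⌋-mono-≤ le)

-- The lower bound on the capture time.

module LowerBound (n : ℕ) (large : 2 ^ 14 ≤ n) where

  private
    large>0 : 0 < n
    large>0 = ≤-trans (≤ᵇ⇒≤ 1 (2 ^ 14) _) large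

    instance
      n≢0 : NonZero n
      n≢0 = >-nonZero large>0

  far⇒2≤ : ∀ {s} → n ≤ 8 * suc s → 2 ≤ s
  far⇒2≤ {s} far = ≮⇒≥ λ s<2 → contradiction
    (≤-trans large (≤-trans far (*-monoʳ-≤ 8 s<2))) (<⇒≱ (≤ᵇ⇒≤ 17 (2 ^ 14) _))

  few-cops-fail : 2 * m ≤ n → ¬ CopsWin (Q n) m
  few-cops-fail {m} 2m≤n (t , cap) =
    let C , wins = captureWithin⇒wins t cap
        R , far  = far-start (≤-trans (m≤n*m m 2) 2m≤n) C
    in few-cops-lose 2m≤n t (C ⊕ R) (λ i → far⇒2≤ (far i)) (wins R)

  private
    L : ℕ
    -- Divisible by every `suc d` with `d ≤ suc n`, so all weights L / (d + 1) are exact.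
    L = (2 + n) !

    instance
      L≢0 : NonZero L
      L≢0 = (2 + n) !≢0

    open Potential n L (λ d → L / suc d)
      (λ {d} d≤ → m/n*n≡m (∣-trans (m∣m*n (d !)) (m≤n⇒m!∣n! (s≤s d≤)))) using (Φ; robber-survives)

    open ≤-Reasoning
    open +-*-Solver

  -- Each cop weighs at most 8 L / n, and there are at most `n` cops.
  Φ-far : m ≤ n → (X : Matrix m n) → (∀ i → n ≤ 8 * suc (size (X i))) → Φ X ≤ 8 * L
  Φ-far {m} m≤n X far = *-cancelʳ-≤ (Φ X) (8 * L) n (begin
    Φ X * n                              ≡⟨ *-distribʳ-sum n (λ i → L / suc (size (X i))) ⟩
    sum (λ i → L / suc (size (X i)) * n) ≤⟨ sum-≤-const each ⟩
    m * (8 * L)                          ≤⟨ *-monoˡ-≤ (8 * L) m≤n ⟩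
    n * (8 * L)                          ≡⟨ *-comm n (8 * L) ⟩
    8 * L * n                            ∎)
    where
    each : ∀ i → L / suc (size (X i)) * n ≤ 8 * L
    each i = begin
      w * n                       ≤⟨ *-monoʳ-≤ w (far i) ⟩
      w * (8 * suc s)             ≡⟨ solve 2 (λ w s → w :* (con 8 :* s) := con 8 :* (w :* s)) refl w (suc s) ⟩
      8 * (w * suc s)             ≤⟨ *-monoʳ-≤ 8 (m/n*n≤m L (suc s)) ⟩
      8 * L                       ∎
      where
      s = size (X i)
      w = L / suc s

  private
    q k horizon : ℕ
    -- The weight at most doubles in `q` rounds. It starts below 8 L and may reach n L / 16, a
    -- factor of n / 2^7, which leaves room for `k` doublings.
    q = n / 8
    k = ⌊log₂ n ⌋ ∸ 7
    horizon = q * k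

    8q≤n : 8 * q ≤ n
    8q≤n = ≤-trans (≤-reflexive (*-comm 8 q)) (m/n*n≤m n 8)

    14≤log : 14 ≤ ⌊log₂ n ⌋
    14≤log = ≤-⌊log₂⌋ 14 large

    7+k≡log : 7 + k ≡ ⌊log₂ n ⌋
    7+k≡log = m+[n∸m]≡n (≤-trans (≤ᵇ⇒≤ 7 14 _) 14≤log)

    128*2^k≤n : 2 ^ 7 * 2 ^ k ≤ n
    128*2^k≤n = begin
      2 ^ 7 * 2 ^ k       ≡⟨ ^-distribˡ-+-* 2 7 k ⟨
      2 ^ (7 + k)         ≡⟨ cong (2 ^_) 7+k≡log ⟩
      2 ^ ⌊log₂ n ⌋       ≤⟨ proj₁ (⌊log₂⌋-bounds n large>0) ⟩
      n                   ∎

  survives-horizon : m ≤ n → (X : Matrix m n) → (∀ i → n ≤ 8 * suc (size (X i))) → ¬ Wins horizon X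
  survives-horizon m≤n X far = robber-survives horizon X (λ i → far⇒2≤ (far i)) (begin
    16 * Φ X * (n + 4) ^ horizon            ≤⟨ *-mono-≤ (*-monoʳ-≤ 16 (Φ-far m≤n X far)) (pow-growth q k 8q≤n) ⟩
    16 * (8 * L) * (2 ^ k * n ^ horizon)    ≡⟨ solve 3 (λ l a b → con 16 :* (con 8 :* l) :* (a :* b) := l :* (con 128 :* a :* b)) refl L (2 ^ k) (n ^ horizon) ⟩
    L * (2 ^ 7 * 2 ^ k * n ^ horizon)       ≤⟨ *-monoʳ-≤ L (*-monoˡ-≤ (n ^ horizon) 128*2^k≤n) ⟩
    L * (n * n ^ horizon)                   ∎)

  -- The factor 32 is 16 · 2: rounding n/8 down costs at most a factor 2, and subtracting 7 from the
  -- logarithm costs another 2.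
  capture-time-lower : m ≤ n → ∀ t → CaptureWithin (Q n) m t → n * ⌊log₂ n ⌋ ≤ 32 * t
  capture-time-lower m≤n t cap = begin
    n * ⌊log₂ n ⌋         ≤⟨ *-mono-≤ n≤16q log≤2k ⟩
    16 * q * (2 * k)      ≡⟨ solve 2 (λ q k → con 16 :* q :* (con 2 :* k) := con 32 :* (q :* k)) refl q k ⟩
    32 * horizon                ≤⟨ *-monoʳ-≤ 32 horizon≤t ⟩
    32 * t                ∎
    where
    horizon≤t : horizon ≤ t
    horizon≤t = ≮⇒≥ λ t<horizon →
      let C , wins = captureWithin⇒wins t cap
          R , far  = far-start m≤n C
      in survives-horizon m≤n (C ⊕ R) far (Wins-mono (C ⊕ R) (<⇒≤ t<horizon) (wins R))
    1≤q : 1 ≤ q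
    1≤q = n≢0⇒n>0 λ q≡0 → contradiction
      (≤-trans (≤-trans (≤ᵇ⇒≤ 8 (2 ^ 14) _) large)
        (≤-reflexive (trans (m≡m%n+[m/n]*n n 8) (trans (cong (λ q → n % 8 + q * 8) q≡0) (+-identityʳ _)))))
      (<⇒≱ (m%n<n n 8))
    n≤16q : n ≤ 16 * q
    n≤16q = begin
      n                   ≡⟨ m≡m%n+[m/n]*n n 8 ⟩
      n % 8 + q * 8       ≤⟨ +-monoˡ-≤ (q * 8) (<⇒≤ (m%n<n n 8)) ⟩
      8 + q * 8           ≤⟨ +-monoˡ-≤ (q * 8) (*-monoˡ-≤ 8 1≤q) ⟩
      q * 8 + q * 8       ≡⟨ solve 1 (λ q → q :* con 8 :+ q :* con 8 := con 16 :* q) refl q ⟩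
      16 * q              ∎
    log≤2k : ⌊log₂ n ⌋ ≤ 2 * k
    -- The threshold 2^14 comes from here: the logarithm is at least 14, so subtracting 7 keeps half
    -- of it.
    log≤2k = begin
      ⌊log₂ n ⌋           ≡⟨ 7+k≡log ⟨
      7 + k               ≤⟨ +-monoˡ-≤ k (∸-monoˡ-≤ 7 14≤log) ⟩
      k + k               ≡⟨ cong (k +_) (+-identityʳ k) ⟨
      2 * k               ∎

-- The cops' strategy

sum-differ-at : (f g : Fin n → ℕ) (i : Fin n) → (∀ {j} → j ≢ i → f j ≡ g j) → sum f + g i ≡ sum g + f i
sum-differ-at f g zero eq = begin
  f zero + sum (f ∘ suc) + g zero    ≡⟨ cong (λ s → f zero + s + g zero) (sum-cong-≗ λ j → eq {suc j} λ ()) ⟩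
  f zero + sum (g ∘ suc) + g zero    ≡⟨ solve 3 (λ a b c → a :+ b :+ c := c :+ b :+ a) refl (f zero) (sum (g ∘ suc)) (g zero) ⟩
  g zero + sum (g ∘ suc) + f zero    ∎
  where
  open ≡-Reasoning
  open +-*-Solver
sum-differ-at f g (suc i) eq = begin
  f zero + sum (f ∘ suc) + g (suc i)    ≡⟨ +-assoc (f zero) (sum (f ∘ suc)) (g (suc i)) ⟩
  f zero + (sum (f ∘ suc) + g (suc i))  ≡⟨ cong₂ _+_ (eq λ ()) (sum-differ-at (f ∘ suc) (g ∘ suc) i λ j≢i → eq λ { refl → j≢i refl }) ⟩
  g zero + (sum (g ∘ suc) + f (suc i))  ≡⟨ +-assoc (g zero) (sum (g ∘ suc)) (f (suc i)) ⟨
  g zero + sum (g ∘ suc) + f (suc i)    ∎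
  where open ≡-Reasoning

size-differ-at : (x y : Row n) (j : Fin n) → (∀ {l} → l ≢ j → x l ≡ y l) → size x + bit (y j) ≡ size y + bit (x j)
size-differ-at x y j eq = sum-differ-at (bit ∘ x) (bit ∘ y) j (cong bit ∘ eq)

Wins-finish : ∀ t (Y : Matrix m n) i → size (Y i) ≤ 1 → Wins (suc t) Y
Wins-finish t Y i le with size (Y i) in eq
... | zero = inj₁ (i , eq)
-- All cops flip `k`, the only coordinate in which cop `i` still differs from the robber.
... | suc zero = inj₂ ((λ _ → just k) , inj₁ (i , suc-injective (trans (size-remove (Y i) yk) eq)))
  where
  element : ∃ λ k → Y i k ≡ true
  element with any? (λ k → Y i k ≟ᵇ true)
  ... | yes p = p
  ... | no ¬p = contradiction (trans (sym eq) (empty-size (Y i) λ l → false! l)) λ ()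
    where
    false! : ∀ l → Y i l ≡ false
    false! l with Y i l in e
    ... | false = refl
    ... | true  = contradiction (l , e) ¬p
  k = proj₁ element
  yk = proj₂ element
Wins-finish t Y i (s≤s ()) | suc (suc _)

-- Choosing entries that the cops can give up.

used : Maybe (Fin n) → ℕ
used (just _) = 1
used nothing  = 0

-- A partial plan, built one pick at a time. By `allowed` every pick is a removal, so carrying the
-- plan out lowers the total by exactly `q`.
record Selection (A : Row m) (s q : ℕ) (X : Matrix m n) : Set where
  field
    pick    : Fin m → Maybe (Fin n)
    allowed : ∀ {i k} → pick i ≡ just k → A i ≡ true × X i k ≡ true
    count   : sum (used ∘ pick) ≡ q
    covered : ∀ l → s ≤ deg (moves pick X) l

open Selection

idle : Maybe (Fin n) → Bool
idle (just _) = false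
idle nothing  = true

module _ {A : Row m} {s q : ℕ} {X : Matrix m n} (S : Selection A s q X) where

  free : Fin m → Bool
  free i = A i ∧ idle (pick S i)

  Removable : Fin m → Fin n → Set
  Removable i k = free i ≡ true × X i k ≡ true × s < deg (moves (pick S) X) k

  Stuck : Set
  Stuck = ∀ k → deg (moves (pick S) X) k ≤ s ⊎ (∀ i → free i ≡ true → X i k ≡ false)

  free⇒ : ∀ {i} → free i ≡ true → A i ≡ true × pick S i ≡ nothing
  free⇒ {i} fr with A i | pick S i
  ... | true | nothing = refl , refl

  extend-by : ∀ {i k} → Removable i k → Selection A s (suc q) X
  extend-by {i} {k} (fr , xik , s<deg) = record
    { pick = a′ ; allowed = allowed′ ; count = count′ ; covered = covered′ }
    where
    a a′ : Fin m → Maybe (Fin n)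
    a  = pick S
    a′ = updateAt a i (const (just k))
    ai : a i ≡ nothing
    ai = proj₂ (free⇒ fr)
    a′i : a′ i ≡ just k
    a′i = updateAt-updates i a
    a′≢ : ∀ {j} → j ≢ i → a′ j ≡ a j
    a′≢ {j} j≢i = updateAt-minimal j i a j≢i
    allowed′ : ∀ {j l} → a′ j ≡ just l → A j ≡ true × X j l ≡ true
    allowed′ {j} e with j ≟ᶠ i
    ... | no j≢i = allowed S (trans (sym (a′≢ j≢i)) e)
    ... | yes refl with trans (sym a′i) e
    ...   | refl = proj₁ (free⇒ fr) , xik
    count′ : sum (used ∘ a′) ≡ suc q
    count′ = begin
      sum (used ∘ a′)                     ≡⟨ +-identityʳ _ ⟨
      sum (used ∘ a′) + 0                 ≡⟨ cong (λ b → sum (used ∘ a′) + used b) ai ⟨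
      sum (used ∘ a′) + used (a i)        ≡⟨ sum-differ-at (used ∘ a′) (used ∘ a) i (cong used ∘ a′≢) ⟩
      sum (used ∘ a) + used (a′ i)        ≡⟨ cong₂ _+_ (count S) (cong used a′i) ⟩
      q + 1                               ≡⟨ +-comm q 1 ⟩
      suc q                               ∎
      where open ≡-Reasoning
    deg′ : ∀ l → deg (moves a′ X) l + bit (X i l) ≡ deg (moves a X) l + bit (move (just k) (X i) l)
    deg′ l = begin
      deg (moves a′ X) l + bit (X i l)
        ≡⟨ cong (λ b → deg (moves a′ X) l + bit (move b (X i) l)) ai ⟨
      deg (moves a′ X) l + bit (moves a X i l)
        ≡⟨ size-differ-at (column l (moves a′ X)) (column l (moves a X)) i (λ {j} j≢i → cong (λ b → move b (X j) l) (a′≢ j≢i)) ⟩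
      deg (moves a X) l + bit (moves a′ X i l)
        ≡⟨ cong (λ b → deg (moves a X) l + bit (move b (X i) l)) a′i ⟩
      deg (moves a X) l + bit (move (just k) (X i) l) ∎
      where open ≡-Reasoning
    covered′ : ∀ l → s ≤ deg (moves a′ X) l
    covered′ l with l ≟ᶠ k
    ... | no l≢k = ≤-trans (covered S l) (≤-reflexive (sym (+-cancelʳ-≡ (bit (X i l)) _ _
            (trans (deg′ l) (cong (λ b → deg (moves a X) l + bit b) (move-off (X i) l≢k))))))
    ... | yes refl = s≤s⁻¹ (≤-trans s<deg (≤-reflexive (begin
        deg (moves a X) k                                ≡⟨ +-identityʳ _ ⟨
        deg (moves a X) k + bit (not true)               ≡⟨ cong (λ b → deg (moves a X) k + bit (not b)) xik ⟨
        deg (moves a X) k + bit (not (X i k))            ≡⟨ cong (λ b → deg (moves a X) k + bit b) (move-at k (X i)) ⟨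
        deg (moves a X) k + bit (move (just k) (X i) k)  ≡⟨ deg′ k ⟨
        deg (moves a′ X) k + bit (X i k)                 ≡⟨ cong (λ b → deg (moves a′ X) k + bit b) xik ⟩
        deg (moves a′ X) k + 1                           ≡⟨ +-comm _ 1 ⟩
        suc (deg (moves a′ X) k)                         ∎)))
      where open ≡-Reasoning

  extend-or-stuck : Selection A s (suc q) X ⊎ Stuck
  extend-or-stuck with any? (λ i → any? λ k →
    (free i ≟ᵇ true) ×-dec ((X i k ≟ᵇ true) ×-dec (s <? deg (moves (pick S) X) k)))
  ... | yes (i , k , r) = inj₁ (extend-by r)
  ... | no ¬r = inj₂ stuck
    where
    stuck : Stuck
    stuck k with deg (moves (pick S) X) k ≤? s
    ... | yes p = inj₁ p
    ... | no ¬p = inj₂ none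
      where
      none : ∀ i → free i ≡ true → X i k ≡ false
      none i fr with X i k in xik
      ... | false = refl
      ... | true  = contradiction (i , k , fr , xik , ≰⇒> ¬p) ¬r

  -- Every row is free, outside `A`, or already picked. The free rows have at most `s` entries in
  -- each column, since otherwise one could be removed; the rows outside `A` are counted as they
  -- are, and each picked row has at most `n` entries.
  stuck-total : Stuck → total X ≤ n * s + sum (λ i → bit (not (A i)) * size (X i)) + q * n
  stuck-total stuck = begin
    total X
      ≤⟨ sum-mono row ⟩
    sum (λ i → bit (free i) * size (X i) + bit (not (A i)) * size (X i) + used (pick S i) * n)
      ≡⟨ ∑-distrib-+ (λ i → bit (free i) * size (X i) + bit (not (A i)) * size (X i)) (λ i → used (pick S i) * n) ⟩
    sum (λ i → bit (free i) * size (X i) + bit (not (A i)) * size (X i)) + sum (λ i → used (pick S i) * n)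
      ≡⟨ cong₂ _+_ (∑-distrib-+ (λ i → bit (free i) * size (X i)) (λ i → bit (not (A i)) * size (X i)))
           (trans (sym (*-distribʳ-sum n (used ∘ pick S))) (cong (_* n) (count S))) ⟩
    sum (λ i → bit (free i) * size (X i)) + W + q * n
      ≤⟨ +-monoˡ-≤ (q * n) (+-monoˡ-≤ W free-total) ⟩
    n * s + W + q * n ∎
    where
    open ≤-Reasoning
    W = sum (λ i → bit (not (A i)) * size (X i))

    row : ∀ i → size (X i) ≤ bit (free i) * size (X i) + bit (not (A i)) * size (X i) + used (pick S i) * n
    row i with A i | pick S i
    ... | true  | nothing = ≤-reflexive (sym (trans (+-identityʳ _) (trans (+-identityʳ _) (+-identityʳ _))))
    ... | true  | just _  = ≤-trans (size≤n (X i)) (≤-reflexive (sym (+-identityʳ n)))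
    ... | false | _       = ≤-trans (≤-reflexive (sym (+-identityʳ _))) (m≤m+n _ _)

    cell : ∀ i k → bit (free i) * bit (X i k) ≤ bit (moves (pick S) X i k)
    cell i k with A i | pick S i
    ... | true  | nothing = ≤-reflexive (+-identityʳ _)
    ... | true  | just _  = z≤n
    ... | false | _       = z≤n

    col : ∀ k → sum (λ i → bit (free i) * bit (X i k)) ≤ s
    col k with stuck k
    ... | inj₁ deg≤s = ≤-trans (sum-mono λ i → cell i k) deg≤s
    ... | inj₂ none  = ≤-trans (sum-≤-const {c = 0} (λ i → zero′ i)) (≤-trans (≤-reflexive (*-zeroʳ m)) z≤n)
      where
      zero′ : ∀ i → bit (free i) * bit (X i k) ≤ 0
      zero′ i with free i | none i
      ... | false | _ = z≤n
      ... | true  | f = ≤-reflexive (trans (+-identityʳ _) (cong bit (f refl)))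

    free-total : sum (λ i → bit (free i) * size (X i)) ≤ n * s
    free-total = begin
      sum (λ i → bit (free i) * size (X i))                ≡⟨ sum-cong-≗ (λ i → *-distribˡ-sum (bit (free i)) (bit ∘ X i)) ⟩
      sum (λ i → sum λ k → bit (free i) * bit (X i k))     ≡⟨ ∑-comm (λ i k → bit (free i) * bit (X i k)) ⟩
      sum (λ k → sum λ i → bit (free i) * bit (X i k))     ≤⟨ sum-≤-const col ⟩
      n * s                                                ∎

no-selection : ∀ {A : Row m} {s} {X : Matrix m n} → (∀ l → s ≤ deg X l) → Selection A s 0 X
no-selection {m} cov = record
  { pick = λ _ → nothing ; allowed = λ () ; count = trans (sum-const m 0) (*-zeroʳ m) ; covered = cov }

-- The total exceeds the bound of `stuck-total` for every number of picks up to `s`, so the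
-- extension never gets stuck.
greedy : ∀ {A : Row m} {s} {X : Matrix m n} → (∀ l → s ≤ deg X l) →
         n * s + sum (λ i → bit (not (A i)) * size (X i)) + s * n < total X →
         ∀ q → q ≤ s → Selection A s q X
greedy cov big zero    _   = no-selection cov
greedy {n = n} cov big (suc q) q<s with extend-or-stuck (greedy cov big q (<⇒≤ q<s))
... | inj₁ S     = S
... | inj₂ stuck = contradiction big (≤⇒≯ (≤-trans (stuck-total (greedy cov big q (<⇒≤ q<s)) stuck)
        (+-monoʳ-≤ _ (*-monoˡ-≤ n (<⇒≤ q<s)))))

subRow : (H : Row m) (s : ℕ) → s ≤ size H → ∃ λ K → size K ≡ s × (∀ i → H i ≡ false → K i ≡ false)
subRow {zero}  H zero    _ = H , refl , λ ()
subRow {suc m} H zero    _ = (λ _ → false) , empty-size {suc m} (λ _ → false) (λ _ → refl) , λ _ _ → refl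
subRow {suc m} H (suc s) le with H zero in h0
... | true  = let K , e , sub = subRow (H ∘ suc) s (s≤s⁻¹ le) in
    (λ { zero → true ; (suc i) → K i }) , cong suc e , λ { zero h → contradiction (trans (sym h0) h) λ () ; (suc i) → sub i }
... | false = let K , e , sub = subRow (H ∘ suc) (suc s) le in
    (λ { zero → false ; (suc i) → K i }) , e , λ { zero _ → refl ; (suc i) → sub i }

-- Replies of the cops that keep every column covered.

-- The deficit allows a single row with one element only.
record Cover (s : ℕ) (X : Matrix m n) : Set where
  field
    deficit   : Fin m → ℕ
    deficit≤1 : sum deficit ≤ 1
    covers    : ∀ l → s ≤ deg X l
    sizes     : ∀ i → 2 ≤ size (X i) + deficit i

open Cover

-- `X` is the position before the robber's move and `Y` the one after it, so the drop by `s` is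
-- measured over a full exchange.
Reply : ℕ → Matrix m n → Matrix m n → Set
Reply {m} {n} s X Y = Σ (Fin m → Maybe (Fin n)) λ a → Cover s (moves a Y) × total (moves a Y) + s ≤ total X

weaken : ∀ {s s′} {X : Matrix m n} → s′ ≤ s → Cover s X → Cover s′ X
weaken s′≤s c = record
  { deficit = deficit c ; deficit≤1 = deficit≤1 c ; sizes = sizes c
  ; covers = λ l → ≤-trans s′≤s (covers c l) }

move-off-twice : ∀ (a : Maybe (Fin n)) {j l} (x : Row n) → l ≢ j → move a (move (just j) x) l ≡ move a x l
move-off-twice nothing  x l≢j = move-off x l≢j
move-off-twice (just k) {j} {l} x l≢j with l ≟ᶠ k
... | yes refl = trans (move-at k _) (trans (cong not (move-off x l≢j)) (sym (move-at k x)))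
... | no  l≢k  = trans (move-off _ l≢k) (trans (move-off x l≢j) (sym (move-off x l≢k)))

module _ {s : ℕ} {X : Matrix m n} (c : Cover s X) (j : Fin n)
         (Y≥2 : ∀ i → 2 ≤ size (move (just j) (X i))) where

  private
    Y : Matrix m n
    Y = flipAll (just j) X

  -- The robber has just removed `j` from this row and two entries remain, so the row may stay
  -- without `j` and needs no deficit.
  flipped-size : ∀ {i} → X i j ≡ true → 3 ≤ size (X i)
  flipped-size {i} xij = ≤-trans (s≤s (Y≥2 i)) (≤-reflexive (size-remove (X i) xij))

  -- Many cops contain j: s of them undo the robber's move, the others keep the gain.
  reply-undo : 2 * s ≤ deg X j → Reply s X Y
  reply-undo 2s≤deg = a , cover , progress
    where
    open ≤-Reasoning
    keep = subRow (column j X) s (≤-trans (m≤n*m s 2) 2s≤deg)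
    K : Row m
    K = proj₁ keep
    size-K : size K ≡ s
    size-K = proj₁ (proj₂ keep)
    sub : ∀ i → X i j ≡ false → K i ≡ false
    sub = proj₂ (proj₂ keep)
    a : Fin m → Maybe (Fin n)
    -- Cops of `K` and cops that lacked `j` reverse the robber's flip; the other cops that had `j`
    -- pass, and their rows stay shorter.
    a i = if K i xor X i j then nothing else just j
    Z : Matrix m n
    Z = moves a Y
    Z-off : ∀ i {l} → l ≢ j → Z i l ≡ X i l
    Z-off i l≢j with K i xor X i j
    ... | true  = move-off (X i) l≢j
    ... | false = move-twice (just j) (X i) _
    Z-at : ∀ i → Z i j ≡ K i
    Z-at i with K i | X i j in xij | sub i
    ... | true  | true  | _ = trans (move-twice (just j) (X i) j) xij
    ... | true  | false | f = contradiction (f refl) λ ()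
    ... | false | true  | _ = trans (move-at j (X i)) (cong not xij)
    ... | false | false | _ = trans (move-twice (just j) (X i) j) xij
    row : ∀ i → size (Z i) + bit (X i j) ≡ size (X i) + bit (K i)
    row i = trans (size-differ-at (Z i) (X i) j (Z-off i)) (cong (λ b → size (X i) + bit b) (Z-at i))
    sizes′ : ∀ i → 2 ≤ size (Z i) + deficit c i
    sizes′ i = case-at (X i j) refl
      where
      case-at : ∀ b → X i j ≡ b → 2 ≤ size (Z i) + deficit c i
      case-at true  xij = ≤-trans (s≤s⁻¹ (begin
          3                            ≤⟨ flipped-size xij ⟩
          size (X i)                   ≤⟨ m≤m+n (size (X i)) (bit (K i)) ⟩
          size (X i) + bit (K i)       ≡⟨ row i ⟨
          size (Z i) + bit (X i j)     ≡⟨ cong (λ b → size (Z i) + bit b) xij ⟩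
          size (Z i) + 1               ≡⟨ +-comm (size (Z i)) 1 ⟩
          suc (size (Z i))             ∎)) (m≤m+n (size (Z i)) (deficit c i))
      case-at false xij = ≤-trans (sizes c i) (+-monoˡ-≤ (deficit c i) (begin
          size (X i)                   ≤⟨ m≤m+n (size (X i)) (bit (K i)) ⟩
          size (X i) + bit (K i)       ≡⟨ row i ⟨
          size (Z i) + bit (X i j)     ≡⟨ cong (λ b → size (Z i) + bit b) xij ⟩
          size (Z i) + 0               ≡⟨ +-identityʳ _ ⟩
          size (Z i)                   ∎))
    covers′ : ∀ l → s ≤ deg Z l
    covers′ l with l ≟ᶠ j
    ... | yes refl = ≤-reflexive (trans (sym size-K) (sym (size-cong Z-at)))
    ... | no  l≢j  = ≤-trans (covers c l) (≤-reflexive (sym (size-cong λ i → Z-off i l≢j)))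
    cover : Cover s Z
    cover = record { deficit = deficit c ; deficit≤1 = deficit≤1 c ; covers = covers′ ; sizes = sizes′ }
    progress : total Z + s ≤ total X
    -- Column `j` shrinks from at least 2s entries to exactly `s`, and no other column changes.
    progress = +-cancelʳ-≤ s (total Z + s) (total X) (begin
      total Z + s + s                              ≡⟨ solve 2 (λ z s → z :+ s :+ s := z :+ con 2 :* s) refl (total Z) s ⟩
      total Z + 2 * s                              ≤⟨ +-monoʳ-≤ (total Z) 2s≤deg ⟩
      total Z + deg X j                            ≡⟨ ∑-distrib-+ (λ i → size (Z i)) (λ i → bit (X i j)) ⟨
      sum (λ i → size (Z i) + bit (X i j))         ≡⟨ sum-cong-≗ row ⟩
      sum (λ i → size (X i) + bit (K i))           ≡⟨ ∑-distrib-+ (λ i → size (X i)) (bit ∘ K) ⟩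
      total X + size K                             ≡⟨ cong (total X +_) size-K ⟩
      total X + s                                  ∎)
      where open +-*-Solver

  -- Cops containing j keep the gain; the selected cops trade another element for j.
  reply-trade : Selection (not ∘ column j X) s s X → Reply s X Y
  reply-trade S = a , cover , progress
    where
    open ≤-Reasoning
    -- A cop that had `j` has lost it and passes. A cop that lacked `j` has gained it and gives it
    -- back, or gives up its pick instead; so column `j` ends with exactly the `s` selected cops.
    response : Bool → Maybe (Fin n) → Maybe (Fin n)
    response true  _        = nothing
    response false nothing  = just j
    response false (just k) = just k
    a : Fin m → Maybe (Fin n)
    a i = response (X i j) (pick S i)
    Z M : Matrix m n
    Z = moves a Y
    M = moves (pick S) X

    record Traded (x : Row n) (b : Maybe (Fin n)) (z : Row n) : Set where
      field
        off      : ∀ {l} → l ≢ j → z l ≡ move b x l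
        at       : bit (z j) ≡ used b
        size-row : size z + bit (x j) ≡ size x
    open Traded

    traded : ∀ i → Traded (X i) (pick S i) (Z i)
    traded i with X i j in xij | pick S i in e
    ... | true | just k = contradiction (trans (sym (cong not xij)) (proj₁ (allowed S e))) λ ()
    ... | true | nothing = record
      { off = move-off (X i)
      ; at  = cong bit (trans (move-at j (X i)) (cong not xij))
      ; size-row = trans (cong (λ b → size (move (just j) (X i)) + bit b) xij) (trans (+-comm _ 1) (size-remove (X i) xij)) }
    ... | false | nothing = record
      { off = λ {l} _ → move-twice (just j) (X i) l
      ; at  = cong bit (trans (move-twice (just j) (X i) j) xij)
      ; size-row = trans (cong (λ b → size (move (just j) (move (just j) (X i))) + bit b) xij) (trans (+-identityʳ _) (size-cong (move-twice (just j) (X i)))) }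
    ... | false | just k = record
      { off = move-off-twice (just k) (X i)
      ; at  = cong bit (trans (move-off (move (just j) (X i)) j≢k) (trans (move-at j (X i)) (cong not xij)))
      ; size-row = trans (cong (λ b → size (move (just k) (move (just j) (X i))) + bit b) xij) (trans (+-identityʳ _) (suc-injective (trans (size-remove (move (just j) (X i)) (trans (move-off (X i) (j≢k ∘ sym)) xik)) (size-insert (X i) xij)))) }
      where
      xik = proj₂ (allowed S e)
      j≢k : j ≢ k
      j≢k refl = contradiction (trans (sym xik) xij) λ ()

    sizes′ : ∀ i → 2 ≤ size (Z i) + deficit c i
    sizes′ i = case-at (X i j) refl
      where
      case-at : ∀ b → X i j ≡ b → 2 ≤ size (Z i) + deficit c i
      case-at true  xij = ≤-trans (s≤s⁻¹ (begin
          3                            ≤⟨ flipped-size xij ⟩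
          size (X i)                   ≡⟨ size-row (traded i) ⟨
          size (Z i) + bit (X i j)     ≡⟨ cong (λ b → size (Z i) + bit b) xij ⟩
          size (Z i) + 1               ≡⟨ +-comm (size (Z i)) 1 ⟩
          suc (size (Z i))             ∎)) (m≤m+n (size (Z i)) (deficit c i))
      case-at false xij = ≤-trans (sizes c i) (+-monoˡ-≤ (deficit c i) (begin
          size (X i)                   ≡⟨ size-row (traded i) ⟨
          size (Z i) + bit (X i j)     ≡⟨ cong (λ b → size (Z i) + bit b) xij ⟩
          size (Z i) + 0               ≡⟨ +-identityʳ _ ⟩
          size (Z i)                   ∎))
    covers′ : ∀ l → s ≤ deg Z l
    covers′ l with l ≟ᶠ j
    ... | yes refl = ≤-reflexive (trans (sym (count S)) (sym (sum-cong-≗ λ i → at (traded i))))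
    ... | no  l≢j  = ≤-trans (covered S l) (≤-reflexive (sym (size-cong λ i → off (traded i) l≢j)))
    cover : Cover s Z
    cover = record { deficit = deficit c ; deficit≤1 = deficit≤1 c ; covers = covers′ ; sizes = sizes′ }
    progress : total Z + s ≤ total X
    -- Exactly the rows that contained `j` lose an entry, and by the covering there are at least `s`
    -- of them.
    progress = begin
      total Z + s                                  ≤⟨ +-monoʳ-≤ (total Z) (covers c j) ⟩
      total Z + deg X j                            ≡⟨ ∑-distrib-+ (λ i → size (Z i)) (λ i → bit (X i j)) ⟨
      sum (λ i → size (Z i) + bit (X i j))         ≡⟨ sum-cong-≗ (λ i → size-row (traded i)) ⟩
      total X                                      ∎

-- The answer to a passing robber: the selection is simply carried out. The deficit `d` is chosen
-- afresh and need not be that of an earlier cover.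
reply-shrink : ∀ {A : Row m} {s} {X : Matrix m n} (S : Selection A s s X) (d : Fin m → ℕ) → sum d ≤ 1 →
               (∀ i → 2 + used (pick S i) ≤ size (X i) + d i) → Reply s X X
reply-shrink {s = s} {X = X} S d d≤1 big = pick S , record
  { deficit = d ; deficit≤1 = d≤1 ; covers = covered S ; sizes = sizes′ } , ≤-reflexive progress
  where
  Z = moves (pick S) X
  row : ∀ i → size (Z i) + used (pick S i) ≡ size (X i)
  row i with pick S i in e
  ... | nothing = +-identityʳ _
  ... | just k  = trans (+-comm _ 1) (size-remove (X i) (proj₂ (allowed S e)))
  sizes′ : ∀ i → 2 ≤ size (Z i) + d i
  sizes′ i = +-cancelʳ-≤ (used (pick S i)) 2 (size (Z i) + d i) (begin
    2 + used (pick S i)                      ≤⟨ big i ⟩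
    size (X i) + d i                         ≡⟨ cong (_+ d i) (row i) ⟨
    size (Z i) + used (pick S i) + d i       ≡⟨ solve 3 (λ z u d → z :+ u :+ d := z :+ d :+ u) refl (size (Z i)) (used (pick S i)) (d i) ⟩
    size (Z i) + d i + used (pick S i)       ∎)
    where
    open ≤-Reasoning
    open +-*-Solver
  progress : total Z + s ≡ total X
  progress = trans (cong (total Z +_) (sym (count S)))
    (trans (sym (∑-distrib-+ (λ i → size (Z i)) (used ∘ pick S))) (sum-cong-≗ row))

-- The threshold 4 n s is what `greedy` may have to pay: n s for the columns, n s for the picked
-- rows, and 2 n s for the excluded rows. The latter are rows with at most two entries if the robber
-- passes, and fewer than 2s rows containing `j` otherwise.
reply-while-large : ∀ {s} {X : Matrix m n} → 1 ≤ s → m ≤ n → Cover s X → 4 * n * s < total X →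
                    ∀ b → (∀ i → 2 ≤ size (move b (X i))) → Reply s X (flipAll b X)
reply-while-large {m} {n} {s} {X} 1≤s m≤n c large nothing Y≥2 =
  reply-shrink S (deficit c) (deficit≤1 c) big
  where
  open ≤-Reasoning
  open +-*-Solver
  A : Row m
  -- Rows with three entries keep two after giving one up.
  A i = 3 ≤ᵇ size (X i)
  small : ∀ x → bit (not (3 ≤ᵇ x)) * x ≤ 2
  small 0 = z≤n
  small 1 = s≤s z≤n
  small 2 = s≤s (s≤s z≤n)
  small (suc (suc (suc _))) = z≤n
  S : Selection A s s X
  S = greedy (covers c) (begin-strict
    n * s + sum (λ i → bit (not (A i)) * size (X i)) + s * n ≤⟨ +-monoˡ-≤ (s * n) (+-monoʳ-≤ (n * s) (sum-≤-const (λ i → small (size (X i))))) ⟩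
    n * s + m * 2 + s * n        ≤⟨ +-monoˡ-≤ (s * n) (+-monoʳ-≤ (n * s) (*-monoˡ-≤ 2 (≤-trans m≤n (m≤m*n n s {{>-nonZero 1≤s}})))) ⟩
    n * s + n * s * 2 + s * n    ≡⟨ solve 2 (λ n s → n :* s :+ n :* s :* con 2 :+ s :* n := con 4 :* n :* s) refl n s ⟩
    4 * n * s                    <⟨ large ⟩
    total X                      ∎) s ≤-refl
  big : ∀ i → 2 + used (pick S i) ≤ size (X i) + deficit c i
  big i with pick S i in e
  ... | nothing = sizes c i
  ... | just k  = ≤-trans (≤ᵇ⇒≤ 3 (size (X i)) (subst T (sym (proj₁ (allowed S e))) tt)) (m≤m+n (size (X i)) (deficit c i))
reply-while-large {m} {n} {s} {X} 1≤s m≤n c large (just j) Y≥2 with 2 * s ≤? deg X j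
... | yes 2s≤deg = reply-undo c j Y≥2 2s≤deg
... | no  deg<2s = reply-trade c j Y≥2 (greedy (covers c) (begin-strict
    n * s + sum (λ i → bit (not (not (X i j))) * size (X i)) + s * n ≤⟨ +-monoˡ-≤ (s * n) (+-monoʳ-≤ (n * s) (sum-mono cell)) ⟩
    n * s + sum (λ i → bit (X i j) * n) + s * n  ≡⟨ cong (λ w → n * s + w + s * n) (*-distribʳ-sum n (bit ∘ column j X)) ⟨
    n * s + deg X j * n + s * n  ≤⟨ +-monoˡ-≤ (s * n) (+-monoʳ-≤ (n * s) (*-monoˡ-≤ n (<⇒≤ (≰⇒> deg<2s)))) ⟩
    n * s + 2 * s * n + s * n    ≡⟨ solve 2 (λ n s → n :* s :+ con 2 :* s :* n :+ s :* n := con 4 :* n :* s) refl n s ⟩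
    4 * n * s                    <⟨ large ⟩
    total X                      ∎) s ≤-refl)
  where
  open ≤-Reasoning
  open +-*-Solver
  cell : ∀ i → bit (not (not (X i j))) * size (X i) ≤ bit (X i j) * n
  cell i with X i j
  ... | true  = *-monoʳ-≤ 1 (size≤n (X i))
  ... | false = z≤n

total-≤n : (X : Matrix m n) → (∀ k → deg X k ≤ 1) → total X ≤ n
total-≤n {n = n} X deg≤1 = ≤-trans (≤-reflexive (total≡sum-deg X)) (≤-trans (sum-≤-const deg≤1) (≤-reflexive (*-identityʳ n)))

-- If no entry can be given up, every column has at most one entry, so the total is at most `n`. But
-- the rows have at least two entries each, up to the deficit, and there are more than n/2 rows.
reply-always : ∀ {X : Matrix m n} → n < 2 * m → Cover 1 X →
               ∀ b → (∀ i → 2 ≤ size (move b (X i))) → Reply 1 X (flipAll b X)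
reply-always {m} {n} {X} n<2m c nothing X≥2 with extend-or-stuck (no-selection {A = λ _ → true} (covers c))
-- All rows have two entries at this moment, so the old deficit is dropped and the row that gives up
-- an entry receives it.
... | inj₁ S = reply-shrink S (used ∘ pick S) (≤-reflexive (count S)) (λ i → +-monoˡ-≤ (used (pick S i)) (X≥2 i))
... | inj₂ stuck = contradiction n<2m (≤⇒≯ (begin
    2 * m     ≡⟨ *-comm 2 m ⟩
    m * 2     ≤⟨ const-≤-sum X≥2 ⟩
    total X   ≤⟨ total-≤n X deg≤1 ⟩
    n         ∎))
  where
  open ≤-Reasoning
  deg≤1 : ∀ k → deg X k ≤ 1
  deg≤1 k with stuck k
  ... | inj₁ p    = p
  ... | inj₂ none = ≤-trans (≤-reflexive (empty-size (column k X) λ i → none i refl)) z≤n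
reply-always {m} {n} {X} n<2m c (just j) Y≥2 with 2 ≤? deg X j
... | yes 2≤deg = reply-undo c j Y≥2 2≤deg
... | no  deg<2 with extend-or-stuck (no-selection {A = not ∘ column j X} (covers c))
...   | inj₁ S = reply-trade c j Y≥2 S
...   | inj₂ stuck = contradiction n<2m (≤⇒≯ (s≤s⁻¹ (begin
    suc (2 * m)                                ≡⟨ trans (+-comm 1 (2 * m)) (cong (_+ 1) (*-comm 2 m)) ⟩
    m * 2 + 1                                  ≤⟨ +-monoʳ-≤ (m * 2) (covers c j) ⟩
    m * 2 + deg X j                            ≡⟨ cong (_+ deg X j) (sum-const m 2) ⟨
    sum {m} (λ _ → 2) + deg X j                ≡⟨ ∑-distrib-+ (λ _ → 2) (bit ∘ column j X) ⟨
    sum (λ i → 2 + bit (X i j))                ≤⟨ sum-mono (λ i → row i (X i j) refl) ⟩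
    -- A row that contained `j` has a third entry; this makes up for the deficit.
    sum (λ i → size (X i) + deficit c i)       ≡⟨ ∑-distrib-+ (λ i → size (X i)) (deficit c) ⟩
    total X + sum (deficit c)                  ≤⟨ +-mono-≤ (total-≤n X deg≤1) (deficit≤1 c) ⟩
    n + 1                                      ≡⟨ +-comm n 1 ⟩
    suc n                                      ∎)))
  where
  open ≤-Reasoning
  deg≤1 : ∀ k → deg X k ≤ 1
  deg≤1 k with stuck k
  ... | inj₁ p    = p
  ... | inj₂ none = ≤-trans (sum-mono sub) (s≤s⁻¹ (≰⇒> deg<2))
    where
    sub : ∀ i → bit (X i k) ≤ bit (X i j)
    sub i with X i j in xij
    ... | true  = bit≤1 (X i k)
    ... | false = ≤-reflexive (cong bit (none i (cong (λ b → not b ∧ true) xij)))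
  row : ∀ i b → X i j ≡ b → 2 + bit b ≤ size (X i) + deficit c i
  row i false _   = sizes c i
  row i true  xij = ≤-trans (flipped-size c j Y≥2 xij) (m≤m+n (size (X i)) (deficit c i))

-- Rounds, levels and halving.

round : ∀ t (Y : Matrix m n) →
        ((∀ i → 2 ≤ size (Y i)) → ∃ λ a → ∀ b → Wins t (flipAll b (moves a Y))) → Wins (suc t) Y
round t Y reply with any? (λ i → size (Y i) ≤? 1)
... | yes (i , le) = Wins-finish t Y i le
... | no ¬small    = let a , wins = reply (λ i → ≰⇒> λ le → ¬small (i , le)) in inj₂ (a , inj₂ wins)

endgame : n < 2 * m → ∀ T (X : Matrix m n) → Cover 1 X → total X ≤ T → ∀ b → Wins (suc T) (flipAll b X)
endgame n<2m zero X c X≤T b = round zero (flipAll b X) λ Y≥2 →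
  let a , _ , drop = reply-always n<2m c b Y≥2
  in contradiction (≤-trans (m≤n+m 1 _) (≤-trans drop X≤T)) λ ()
endgame n<2m (suc T) X c X≤T b = round (suc T) (flipAll b X) λ Y≥2 →
  let a , c′ , drop = reply-always n<2m c b Y≥2
  in a , endgame n<2m T _ c′ (s≤s⁻¹ (≤-trans (≤-reflexive (+-comm 1 _)) (≤-trans drop X≤T)))

WinsFromLevel : (m n s t : ℕ) → Set
WinsFromLevel m n s t = ∀ (X : Matrix m n) → Cover s X → total X ≤ 4 * n * s → ∀ b → Wins t (flipAll b X)

-- Each round above the level removes at least `s` from the total, so an excess of `T * s` lasts at
-- most `T` rounds. Once the level is reached, the remaining rounds are only slack.
descend : ∀ {s t} → 1 ≤ s → m ≤ n → WinsFromLevel m n s t →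
          ∀ T (X : Matrix m n) → Cover s X → total X ≤ 4 * n * s + T * s → ∀ b → Wins (T + t) (flipAll b X)
descend 1≤s m≤n level zero X c X≤ = level X c (≤-trans X≤ (≤-reflexive (+-identityʳ _)))
descend {n = n} {s} {t} 1≤s m≤n level (suc T) X c X≤ b with total X ≤? 4 * n * s
... | yes le = Wins-suc {t = T + t} (flipAll b X) (descend 1≤s m≤n level T X c (≤-trans le (m≤m+n _ _)) b)
... | no  gt = round (T + t) (flipAll b X) λ Y≥2 →
  let a , c′ , drop = reply-while-large 1≤s m≤n c (≰⇒> gt) b Y≥2
  in a , descend 1≤s m≤n level T _ c′ (+-cancelʳ-≤ s _ _ (≤-trans drop (≤-trans X≤ (≤-reflexive
       (solve 3 (λ p T s → p :+ (s :+ T :* s) := p :+ T :* s :+ s) refl (4 * n * s) T s)))))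
  where open +-*-Solver

-- Measured against the new level 4 n s′, the excess is at most 4 n s′, that is, `4 * n` rounds of
-- `s′` each.
halve : ∀ {s s′ t} → 1 ≤ s′ → s′ ≤ s → s ≤ 2 * s′ → m ≤ n →
        WinsFromLevel m n s′ t → WinsFromLevel m n s (4 * n + t)
halve {n = n} {s} {s′} 1≤s′ s′≤s s≤2s′ m≤n level X c X≤ =
  descend 1≤s′ m≤n level (4 * n) X (weaken s′≤s c) (begin
    total X                        ≤⟨ X≤ ⟩
    4 * n * s                      ≤⟨ *-monoʳ-≤ (4 * n) s≤2s′ ⟩
    4 * n * (2 * s′)               ≡⟨ solve 2 (λ p s → p :* (con 2 :* s) := p :* s :+ p :* s) refl (4 * n) s′ ⟩
    4 * n * s′ + 4 * n * s′        ∎)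
  where
  open ≤-Reasoning
  open +-*-Solver

level-time : ℕ → ℕ → ℕ
level-time n e = e * (4 * n) + suc (4 * n)

-- Halving with rounding up keeps `s` positive and reaches 1 after `e` steps; `endgame` then needs
-- one round per remaining entry and one to finish.
wins-from-level : n < 2 * m → m ≤ n → ∀ e s → 1 ≤ s → s ≤ 2 ^ e → WinsFromLevel m n s (level-time n e)
wins-from-level {n} n<2m m≤n zero s 1≤s s≤1 X c X≤ =
  endgame n<2m (4 * n) X (weaken 1≤s c) (≤-trans X≤ (≤-trans (*-monoʳ-≤ (4 * n) s≤1) (≤-reflexive (*-identityʳ (4 * n)))))
wins-from-level {n} {m} n<2m m≤n (suc e) s 1≤s s≤ =
  subst (WinsFromLevel m n s) (sym (+-assoc (4 * n) (e * (4 * n)) (suc (4 * n))))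
    (halve (⌈n/2⌉-mono 1≤s) (⌈n/2⌉≤n s) s≤2⌈s/2⌉ m≤n
      (wins-from-level n<2m m≤n e ⌈ s /2⌉ (⌈n/2⌉-mono 1≤s) ⌈s/2⌉≤))
  where
  open ≤-Reasoning
  s≤2⌈s/2⌉ : s ≤ 2 * ⌈ s /2⌉
  s≤2⌈s/2⌉ = begin
    s                        ≡⟨ ⌊n/2⌋+⌈n/2⌉≡n s ⟨
    ⌊ s /2⌋ + ⌈ s /2⌉        ≤⟨ +-monoˡ-≤ ⌈ s /2⌉ (⌊n/2⌋≤⌈n/2⌉ s) ⟩
    ⌈ s /2⌉ + ⌈ s /2⌉        ≡⟨ cong (⌈ s /2⌉ +_) (+-identityʳ ⌈ s /2⌉) ⟨
    2 * ⌈ s /2⌉              ∎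
  ⌈s/2⌉≤ : ⌈ s /2⌉ ≤ 2 ^ e
  ⌈s/2⌉≤ = begin
    ⌈ s /2⌉                  ≤⟨ ⌈n/2⌉-mono s≤ ⟩
    ⌈ 2 * 2 ^ e /2⌉          ≡⟨ cong (λ k → ⌈ 2 ^ e + k /2⌉) (+-identityʳ (2 ^ e)) ⟩
    ⌈ 2 ^ e + 2 ^ e /2⌉      ≡⟨ n≡⌈n+n/2⌉ (2 ^ e) ⟨
    2 ^ e                    ∎

-- The cops' start and the upper bound.

alternate : Fin m → Bool
alternate zero          = true
alternate (suc zero)    = false
alternate (suc (suc i)) = alternate i

antipodal : Matrix m n
antipodal i _ = alternate i

antipodal-deg : ∀ m b → ⌊ m /2⌋ ≤ sum {m} (λ i → bit (alternate i xor b))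
antipodal-deg zero          b     = z≤n
antipodal-deg (suc zero)    b     = z≤n
antipodal-deg (suc (suc m)) true  = s≤s (antipodal-deg m true)
antipodal-deg (suc (suc m)) false = s≤s (antipodal-deg m false)

capture-time-upper : 2 ≤ m → n < 2 * m → m ≤ n → CaptureWithin (Q n) m (suc (level-time n (suc ⌊log₂ n ⌋)))
capture-time-upper {m} {n} 2≤m n<2m m≤n = wins⇒captureWithin _ antipodal λ R →
  -- The cops pass in the first round, because `WinsFromLevel` begins with a robber move.
  round _ (antipodal ⊕ R) λ X≥2 → (λ _ → nothing) ,
    wins-from-level n<2m m≤n (suc ⌊log₂ n ⌋) s 1≤s s≤ (antipodal ⊕ R) (cover R X≥2)
      (≤-trans (sum-≤-const {n = m} (λ i → size≤n ((antipodal ⊕ R) i))) mn≤)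
  where
  open ≤-Reasoning
  open +-*-Solver
  s = ⌊ m /2⌋
  1≤s : 1 ≤ s
  1≤s = ⌊n/2⌋-mono 2≤m
  s≤ : s ≤ 2 ^ suc ⌊log₂ n ⌋
  s≤ = ≤-trans (⌊n/2⌋≤n m) (≤-trans m≤n (<⇒≤ (proj₂ (⌊log₂⌋-bounds n (≤-trans (≤-trans (s≤s z≤n) 2≤m) m≤n)))))
  cover : ∀ R → (∀ i → 2 ≤ size ((antipodal ⊕ R) i)) → Cover s (antipodal ⊕ R)
  cover R X≥2 = record
    { deficit   = λ _ → 0
    ; deficit≤1 = ≤-trans (≤-reflexive (trans (sum-const m 0) (*-zeroʳ m))) z≤n
    ; covers    = λ l → antipodal-deg m (R l)
    ; sizes     = λ i → ≤-trans (X≥2 i) (m≤m+n _ 0) }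
  mn≤ : m * n ≤ 4 * n * s
  mn≤ = begin
    m * n                    ≡⟨ cong (_* n) (⌊n/2⌋+⌈n/2⌉≡n m) ⟨
    (s + ⌈ m /2⌉) * n        ≤⟨ *-monoˡ-≤ n (+-monoʳ-≤ s (⌊n/2⌋-mono {suc m} {suc (suc m)} (n≤1+n (suc m)))) ⟩
    -- From m ≤ 2s + 1 and 1 ≤ s follows m ≤ 3s, which fits the level 4 n s.
    (s + suc s) * n          ≤⟨ *-monoˡ-≤ n (+-monoʳ-≤ s (+-monoˡ-≤ s 1≤s)) ⟩
    (s + (s + s)) * n        ≤⟨ m≤m+n _ (s * n) ⟩
    (s + (s + s)) * n + s * n ≡⟨ solve 2 (λ s n → (s :+ (s :+ s)) :* n :+ s :* n := con 4 :* n :* s) refl s n ⟩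
    4 * n * s                ∎

-- Deciding the game

-- `IsCapt` asks for the exact capture time. Exhaustive search decides each finite game, so the
-- least number of rounds can be found constructively below a known upper bound.
Searchable : Set → Set₁
Searchable A = ∀ {P : A → Set} → Decidable P → Dec (∃ P)

search-Bool : Searchable Bool
search-Bool P? = map′ (λ { (inj₁ p) → true , p ; (inj₂ p) → false , p })
  (λ { (true , p) → inj₁ p ; (false , p) → inj₂ p }) (P? true ⊎-dec P? false)

search-Vec : ∀ {A} → Searchable A → ∀ n → Searchable (Vec A n)
search-Vec search zero    P? = map′ (λ p → [] , p) (λ { ([] , p) → p }) (P? [])
search-Vec search (suc n) P? = map′ (λ { (x , xs , p) → x ∷ xs , p }) (λ { (x ∷ xs , p) → x , xs , p })
  (search λ x → search-Vec search n λ xs → P? (x ∷ xs))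

Searchable⇒∀? : ∀ {A} → Searchable A → {P : A → Set} → Decidable P → Dec (∀ x → P x)
Searchable⇒∀? search P? with search (¬? ∘ P?)
... | yes (x , ¬p) = no λ all → ¬p (all x)
... | no  ¬∃       = yes λ x → decidable-stable (P? x) λ ¬p → ¬∃ (x , ¬p)

module _ {n : ℕ} where

  private
    search-Cube : Searchable (Cube n)
    search-Cube = search-Vec search-Bool n

    _≟ᶜ_ : (u v : Cube n) → Dec (u ≡ v)
    _≟ᶜ_ = ≡-dec _≟ᵇ_

  N? : ∀ u v → Dec (N (Q n) u v)
  N? u v = (u ≟ᶜ v) ⊎-dec any? (λ k → v ≟ᶜ (u [ k ]%= not))

  caught? : ∀ (cs : Vec (Cube n) m) r → Dec (Caught (Q n) cs r)
  caught? cs r = Any.any? (λ c → c ≟ᶜ r) cs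

  copsWin? : ∀ t (cs : Vec (Cube n) m) r → Dec (CopsWinWithin (Q n) t cs r)
  copsWin? zero    cs r = caught? cs r
  copsWin? (suc t) cs r = caught? cs r ⊎-dec search-Vec search-Cube _ λ cs' →
    Pointwise.decidable N? cs cs' ×-dec
    (caught? cs' r ⊎-dec Searchable⇒∀? search-Cube λ r' → N? r r' →-dec copsWin? t cs' r')

  captureWithin? : ∀ k t → Dec (CaptureWithin (Q n) k t)
  captureWithin? k t = search-Vec search-Cube k λ cs → Searchable⇒∀? search-Cube λ r → copsWin? t cs r

least : {P : ℕ → Set} → Decidable P → ∀ t → P t → ∃ λ s → s ≤ t × P s × (∀ r → r < s → ¬ P r)
least P? t p with P? 0
... | yes p₀ = 0 , z≤n , p₀ , λ _ ()
least P? zero    p | no ¬p₀ = contradiction p ¬p₀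
least P? (suc t) p | no ¬p₀ with least (P? ∘ suc) t p
... | s , s≤t , ps , min = suc s , s≤s s≤t , ps , λ { zero _ → ¬p₀ ; (suc r) (s≤s r<s) → min r r<s }

-- For n ≥ 2 the floor of the binary logarithm is within constant factors of ln n, so the bounds are
-- those of Θ(n ln n) in natural numbers.
theorem1p1 : Σ ℕ λ a → Σ ℕ λ b → Σ ℕ λ n₀ →
    (0 < a) × (0 < b) × (2 ≤ n₀) ×
    (∀ n → n₀ ≤ n → Σ ℕ λ t → IsCapt (Q n) t ×
    (n * ⌊log₂ n ⌋ ≤ a * t) × (t ≤ b * (n * ⌊log₂ n ⌋)))
theorem1p1 = 32 , 13 , 2 ^ 14 , ≤ᵇ⇒≤ 1 32 _ , ≤ᵇ⇒≤ 1 13 _ , ≤ᵇ⇒≤ 2 (2 ^ 14) _ , bounds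
  where
  bounds : ∀ n → 2 ^ 14 ≤ n → Σ ℕ λ t → IsCapt (Q n) t ×
           (n * ⌊log₂ n ⌋ ≤ 32 * t) × (t ≤ 13 * (n * ⌊log₂ n ⌋))
  bounds n large =
    let t , t≤rounds , cap , min = least (captureWithin? k) rounds upper
    in t , (k , ((rounds , upper) , fewer) , cap , min) , capture-time-lower k≤n t cap , ≤-trans t≤rounds rounds≤
    where
    open ≤-Reasoning
    open +-*-Solver
    open LowerBound n large
    l k rounds : ℕ
    l = ⌊log₂ n ⌋
    -- This is ⌈(n + 1)/2⌉, the cop number of the cube.
    k = suc ⌊ n /2⌋
    rounds = suc (level-time n (suc l))
    2≤n : 2 ≤ n
    2≤n = ≤-trans (≤ᵇ⇒≤ 2 (2 ^ 14) _) large
    1≤l : 1 ≤ l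
    1≤l = ≤-⌊log₂⌋ 1 2≤n
    k≤n : k ≤ n
    k≤n = ⌊n/2⌋<n′ n (≤-trans (≤ᵇ⇒≤ 1 2 _) 2≤n)
      where
      ⌊n/2⌋<n′ : ∀ n → 1 ≤ n → ⌊ n /2⌋ < n
      ⌊n/2⌋<n′ (suc n) _ = ⌊n/2⌋<n n
    n<2k : n < 2 * k
    n<2k = begin-strict
      n                          <⟨ n<1+n n ⟩
      suc n                      ≡⟨ ⌊n/2⌋+⌈n/2⌉≡n (suc n) ⟨
      ⌈ n /2⌉ + k                ≤⟨ +-monoˡ-≤ k (⌊n/2⌋-mono {suc n} {suc (suc n)} (n≤1+n (suc n))) ⟩
      k + k                      ≡⟨ cong (k +_) (+-identityʳ k) ⟨
      2 * k                      ∎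
    upper : CaptureWithin (Q n) k rounds
    upper = capture-time-upper (s≤s (⌊n/2⌋-mono 2≤n)) n<2k k≤n
    fewer : ∀ j → j < k → CopsWin (Q n) j → ⊥
    fewer j j<k = few-cops-fail (begin
      2 * j                      ≤⟨ *-monoʳ-≤ 2 (s≤s⁻¹ j<k) ⟩
      2 * ⌊ n /2⌋                ≡⟨ cong (⌊ n /2⌋ +_) (+-identityʳ ⌊ n /2⌋) ⟩
      ⌊ n /2⌋ + ⌊ n /2⌋          ≤⟨ +-monoʳ-≤ ⌊ n /2⌋ (⌊n/2⌋≤⌈n/2⌉ n) ⟩
      ⌊ n /2⌋ + ⌈ n /2⌉          ≡⟨ ⌊n/2⌋+⌈n/2⌉≡n n ⟩
      n                          ∎)
    n≤nl : n ≤ n * l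
    n≤nl = m≤m*n n l {{>-nonZero 1≤l}}
    rounds≤ : rounds ≤ 13 * (n * l)
    rounds≤ = begin
      suc (suc l * (4 * n) + suc (4 * n))
        ≡⟨ solve 2 (λ n l → con 1 :+ ((con 1 :+ l) :* (con 4 :* n) :+ (con 1 :+ con 4 :* n)) := con 2 :+ (con 8 :* n :+ con 4 :* (n :* l))) refl n l ⟩
      2 + (8 * n + 4 * (n * l))
        -- The terms without a logarithm are absorbed into `n * l`, since 1 ≤ `l`; this gives 13 = 1
        -- + 8 + 4.
        ≤⟨ +-mono-≤ (≤-trans 2≤n n≤nl) (+-monoˡ-≤ (4 * (n * l)) (*-monoʳ-≤ 8 n≤nl)) ⟩
      n * l + (8 * (n * l) + 4 * (n * l))
        ≡⟨ solve 1 (λ p → p :+ (con 8 :* p :+ con 4 :* p) := con 13 :* p) refl (n * l) ⟩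
      13 * (n * l) ∎
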